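{- Define $\lambda_t\in\mathbb{R}_+^m$ for $1\le t\le\tau_2$ by $$\lambda_t=\begin{cases}\dfrac{1}{1+\ln(\tau_2/\tau_1)}\cdot\dfrac{B}{\tau_1}&\text{if }t\le\tau_1,\\[2mm]\dfrac{1}{1+\ln(\tau_2/\tau_1)}\cdot\dfrac{B}{t}&\text{if }\tau_1+1\le t\le\tau_2.\end{cases}$$ Then $\sum_{t=1}^{\tau_2}\lambda_t\le B$ and $c(\vec\lambda,T)\ge\frac{1}{1+\ln(\tau_2/\tau_1)}$ for all $T\in[\tau_1,\tau_2]$. Consequently, $$\max_{\vec\lambda}\min_{T\in[\tau_1,\tau_2]}c(\vec\lambda,T)\ge\frac{1}{1+\ln(\tau_2/\tau_1)},$$ where the maximum is over all target consumption sequences $\vec\lambda$.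
   Context: $m\ge1$ is the number of resources, $B\in\mathbb{R}_{++}^m$ is the initial resource endowment, $1\le\tau_1\le\tau_2$ are integers, $T$ ranges over integers in $[\tau_1,\tau_2]$, and $\rho_T=B/T$. Vector inequalities are componentwise. A target consumption sequence is a sequence $\vec\lambda=(\lambda_1,\dots,\lambda_{\tau_2})$ with $\lambda_t\in\mathbb{R}_+^m$ for all $t$, $\lambda_1>0$, and $\sum_{t=1}^{\tau_2}\lambda_t\le B$. For such $\vec\lambda$, $$c(\vec\lambda,T)=\frac1T\sum_{t=1}^T\min\Big\{\min_{1\le j\le m}\frac{\lambda_{t,j}}{\rho_{T,j}},1\Big\}.$$ -}

module Defs where

open import Algebra.Bundles using (CommutativeRing)
open import Data.Bool.Base using (if_then_else_)
open import Data.Empty using (⊥-elim)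
open import Data.Fin.Base using (Fin; toℕ) renaming (zero to fzero; suc to fsuc)
open import Data.Nat.Base as ℕ using (ℕ; zero; suc; _∸_; NonZero)
import Data.Nat.Properties as ℕ using (_≤?_)
open import Data.Product.Base using (_×_; _,_; proj₁; proj₂; Σ-syntax; ∃-syntax)
open import Data.Sum.Base using (inj₁; inj₂)
open import Function.Base using (_∘_)
open import Level using (_⊔_; Lift; lift) renaming (suc to lsuc)
open import Relation.Binary.Bundles using (DecTotalOrder; StrictTotalOrder)
open import Relation.Binary.Structures using (IsDecTotalOrder)
open import Relation.Nullary using (¬_; yes; no; does)

-- The real numbers enter as an arbitrary complete ordered field; classically
-- this determines ℝ up to unique isomorphism.  As in most proof assistants
-- `_⁻¹` is total, with an unspecified value at 0#; every division in the
-- definitions below is by a positive number wherever it matters.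

record CompleteOrderedField a ℓ₁ ℓ₂ : Set (lsuc (a ⊔ ℓ₁ ⊔ ℓ₂)) where
  infix  4 _≤_
  infix  9 _⁻¹
  infixl 7 _/_
  field
    commutativeRing : CommutativeRing a ℓ₁

  open CommutativeRing commutativeRing public

  field
    _≤_             : Carrier → Carrier → Set ℓ₂
    isDecTotalOrder : IsDecTotalOrder _≈_ _≤_
    +-monoˡ-≤       : ∀ z {x y} → x ≤ y → x + z ≤ y + z
    *-nonNeg        : ∀ {x y} → 0# ≤ x → 0# ≤ y → 0# ≤ x * y
    1≉0             : ¬ (1# ≈ 0#)
    _⁻¹             : Carrier → Carrier
    ⁻¹-cong         : ∀ {x y} → x ≈ y → x ⁻¹ ≈ y ⁻¹
    ⁻¹-inverseʳ     : ∀ {x} → ¬ (x ≈ 0#) → x * x ⁻¹ ≈ 1#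

  IsUpperBound : (Carrier → Set (a ⊔ ℓ₁ ⊔ ℓ₂)) → Carrier → Set (a ⊔ ℓ₁ ⊔ ℓ₂)
  IsUpperBound P u = ∀ x → P x → x ≤ u

  field
    complete : (P : Carrier → Set (a ⊔ ℓ₁ ⊔ ℓ₂)) →
               (∃[ x ] P x) → (∃[ u ] IsUpperBound P u) →
               ∃[ s ] (IsUpperBound P s × (∀ u → IsUpperBound P u → s ≤ u))

  decTotalOrder : DecTotalOrder a ℓ₁ ℓ₂
  decTotalOrder = record { isDecTotalOrder = isDecTotalOrder }

  open DecTotalOrder decTotalOrder public
    using (_≟_; _≤?_; total; antisym; totalOrder; ≤-respˡ-≈; ≤-respʳ-≈)
    renaming ( refl to ≤-refl; trans to ≤-trans; reflexive to ≤-reflexive )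

  open import Relation.Binary.Properties.DecTotalOrder decTotalOrder public
    using (_<_; <-strictTotalOrder; <⇒≱; ≰⇒>)
  open StrictTotalOrder <-strictTotalOrder public using (_<?_)

  open import Algebra.Construct.NaturalChoice.Min totalOrder public using (_⊓_)

  open import Algebra.Properties.Monoid.Sum +-monoid public using (sum; sum-syntax)
  open import Algebra.Definitions.RawMonoid +-rawMonoid public
    using () renaming (_×_ to _·_)

  _/_ : Carrier → Carrier → Carrier
  x / y = x * y ⁻¹

  fromℕ : ℕ → Carrier
  fromℕ n = n · 1#

module _ {a ℓ₁ ℓ₂} (ℝ : CompleteOrderedField a ℓ₁ ℓ₂) where

  open CompleteOrderedField ℝ

  -- A step function on [x , y], given by a partition and the value on each
  -- piece of it.

  data Steps (y : Carrier) (x : Carrier) : Set (a ⊔ ℓ₂) where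
    last : x ≤ y → Carrier → Steps y x
    step : ∀ p → x ≤ p → Carrier → Steps y p → Steps y x

  area : ∀ {x y} → Steps y x → Carrier
  area {x} {y} (last _ v)     = v * (y - x)
  area {x} {y} (step p _ v s) = v * (p - x) + area s

  Below : ∀ {x y} → (Carrier → Carrier) → Steps y x → Set (a ⊔ ℓ₂)
  Below {x} {y} f (last _ v)     = ∀ u → x ≤ u → u ≤ y → v ≤ f u
  Below {x} {y} f (step p _ v s) = (∀ u → x ≤ u → u ≤ p → v ≤ f u) × Below f s

  Above : ∀ {x y} → (Carrier → Carrier) → Steps y x → Set (a ⊔ ℓ₂)
  Above {x} {y} f (last _ v)     = ∀ u → x ≤ u → u ≤ y → f u ≤ v
  Above {x} {y} f (step p _ v s) = (∀ u → x ≤ u → u ≤ p → f u ≤ v) × Above f s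

  -- The Darboux integral: I is both the supremum of the areas of the step
  -- functions below f and the infimum of the areas of those above f.

  record IsIntegral (f : Carrier → Carrier) (x y I : Carrier) : Set (a ⊔ ℓ₂) where
    field
      lower    : ∀ (s : Steps y x) → Below f s → area s ≤ I
      least    : ∀ K → (∀ (s : Steps y x) → Below f s → area s ≤ K) → I ≤ K
      upper    : ∀ (s : Steps y x) → Above f s → I ≤ area s
      greatest : ∀ K → (∀ (s : Steps y x) → Above f s → K ≤ area s) → K ≤ I

  module Lemmas where
    open import Algebra.Properties.Ring ring
      using (-‿distribˡ-*)
    open import Algebra.Properties.AbelianGroup +-abelianGroup
      using (⁻¹-involutive)
    open import Relation.Binary.Reasoning.Setoid setoid

    ≤-resp : ∀ {x x′ y y′} → x ≈ x′ → y ≈ y′ → x ≤ y → x′ ≤ y′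
    ≤-resp p q r = ≤-respˡ-≈ p (≤-respʳ-≈ q r)

    +-mono : ∀ {x y u v} → x ≤ y → u ≤ v → x + u ≤ y + v
    +-mono {x} {y} {u} {v} p q =
      ≤-trans (+-monoˡ-≤ u p) (≤-resp (+-comm u y) (+-comm v y) (+-monoˡ-≤ y q))

    cancel : ∀ x y → (x + y) - y ≈ x
    cancel x y = trans (+-assoc x y (- y)) (trans (+-congˡ (-‿inverseʳ y)) (+-identityʳ x))

    cancel′ : ∀ x y → (x - y) + y ≈ x
    cancel′ x y = trans (+-assoc x (- y) y) (trans (+-congˡ (-‿inverseˡ y)) (+-identityʳ x))

    +-cancel-≤ : ∀ z {x y} → x + z ≤ y + z → x ≤ y
    +-cancel-≤ z {x} {y} p = ≤-resp (cancel x z) (cancel y z) (+-monoˡ-≤ (- z) p)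

    0≤y-x : ∀ {x y} → x ≤ y → 0# ≤ y - x
    0≤y-x {x} p = ≤-respˡ-≈ (-‿inverseʳ x) (+-monoˡ-≤ (- x) p)

    chain : ∀ x p y → y - x ≈ (p - x) + (y - p)
    chain x p y = begin
      y - x               ≈⟨ +-congʳ (cancel′ y p) ⟨
      ((y - p) + p) - x   ≈⟨ +-assoc (y - p) p (- x) ⟩
      (y - p) + (p - x)   ≈⟨ +-comm (y - p) (p - x) ⟩
      (p - x) + (y - p)   ∎

    *-chain : ∀ v x p y → v * (y - x) ≈ v * (p - x) + v * (y - p)
    *-chain v x p y = trans (*-congˡ (chain x p y)) (distribˡ v (p - x) (y - p))

    *-monoʳ : ∀ {v w z} → 0# ≤ z → v ≤ w → v * z ≤ w * z
    *-monoʳ {v} {w} {z} p q =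
      ≤-resp (+-identityˡ (v * z))
             (trans (sym (distribʳ z (w - v) v)) (*-congʳ (cancel′ w v)))
             (+-monoˡ-≤ (v * z) (*-nonNeg (0≤y-x q) p))

    ends : ∀ {x y} → Steps y x → x ≤ y
    ends (last q _)     = q
    ends (step p q _ s) = ≤-trans q (ends s)

    module _ {f : Carrier → Carrier} where

      split : ∀ {x y} p → x ≤ p → p ≤ y → (s : Steps y x) → Above f s →
              Σ[ s₁ ∈ Steps p x ] Σ[ s₂ ∈ Steps y p ]
              Above f s₁ × Above f s₂ × area s ≈ area s₁ + area s₂
      split {x} {y} p x≤p p≤y (last _ w) h =
        last x≤p w , last p≤y w ,
        (λ u q r → h u q (≤-trans r p≤y)) , (λ u q r → h u (≤-trans x≤p q) r) ,
        *-chain w x p y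
      split {x} {y} p x≤p p≤y (step q x≤q w s) (h , hs) with total p q
      ... | inj₁ p≤q =
        last x≤p w , step q p≤q w s ,
        (λ u i j → h u i (≤-trans j p≤q)) , ((λ u i j → h u (≤-trans x≤p i) j) , hs) ,
        trans (+-congʳ (*-chain w x p q)) (+-assoc _ _ _)
      ... | inj₂ q≤p with split p q≤p p≤y s hs
      ...   | s₁ , s₂ , h₁ , h₂ , e =
        step q x≤q w s₁ , s₂ , (h , h₁) , h₂ ,
        trans (+-congˡ e) (sym (+-assoc _ _ _))

      const≤upper : ∀ {x y} v → (∀ u → x ≤ u → u ≤ y → v ≤ f u) →
                    (s : Steps y x) → Above f s → v * (y - x) ≤ area s
      const≤upper {x} v h (last x≤y w) hs =
        *-monoʳ (0≤y-x x≤y) (≤-trans (h x ≤-refl x≤y) (hs x ≤-refl x≤y))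
      const≤upper {x} {y} v h (step p x≤p w s) (hw , hs) =
        ≤-respˡ-≈ (sym (*-chain v x p y))
          (+-mono (*-monoʳ (0≤y-x x≤p) (≤-trans (h x ≤-refl (≤-trans x≤p (ends s)))
                                                (hw x ≤-refl x≤p)))
                  (const≤upper v (λ u i j → h u (≤-trans x≤p i) j) s hs))

      lower≤upper : ∀ {x y} (s s′ : Steps y x) → Below f s → Above f s′ →
                    area s ≤ area s′
      lower≤upper (last _ v) s′ h h′ = const≤upper v h s′ h′
      lower≤upper (step p x≤p v s) s′ (h , hs) h′ with split p x≤p (ends s) s′ h′
      ... | s₁ , s₂ , h₁ , h₂ , e =
        ≤-respʳ-≈ (sym e) (+-mono (const≤upper v h s₁ h₁) (lower≤upper s s₂ hs h₂))

    0≤1 : 0# ≤ 1#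
    0≤1 with total 0# 1#
    ... | inj₁ p = p
    ... | inj₂ p = ≤-respʳ-≈ -1*-1≈1 (*-nonNeg 0≤-1 0≤-1)
      where
      0≤-1 : 0# ≤ - 1#
      0≤-1 = ≤-respʳ-≈ (+-identityˡ (- 1#)) (0≤y-x p)
      -1*-1≈1 : - 1# * - 1# ≈ 1#
      -1*-1≈1 = begin
        - 1# * - 1#     ≈⟨ -‿distribˡ-* 1# (- 1#) ⟨
        - (1# * - 1#)   ≈⟨ -‿cong (*-identityˡ (- 1#)) ⟩
        - (- 1#)        ≈⟨ ⁻¹-involutive 1# ⟩
        1#              ∎

    pos⇒≉0 : ∀ {x} → 0# < x → ¬ (x ≈ 0#)
    pos⇒≉0 (_ , ne) e = ne (sym e)

    <-≤-trans : ∀ {x y z} → x < y → y ≤ z → x < z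
    <-≤-trans p@(x≤y , ne) y≤z =
      ≤-trans x≤y y≤z , λ e → <⇒≱ p (≤-respʳ-≈ (sym e) y≤z)

    ⁻¹-nonNeg : ∀ {x} → 0# < x → 0# ≤ x ⁻¹
    ⁻¹-nonNeg {x} 0<x with total 0# (x ⁻¹)
    ... | inj₁ p = p
    ... | inj₂ p = ⊥-elim (1≉0 (antisym 1≤0 0≤1))
      where
      0≤-x⁻¹ : 0# ≤ - (x ⁻¹)
      0≤-x⁻¹ = ≤-respʳ-≈ (+-identityˡ _) (0≤y-x p)
      1≤0 : 1# ≤ 0#
      1≤0 = ≤-resp (+-identityˡ 1#)
        (begin
          x * - (x ⁻¹) + 1#        ≈⟨ +-congˡ (⁻¹-inverseʳ (pos⇒≉0 0<x)) ⟨
          x * - (x ⁻¹) + x * x ⁻¹  ≈⟨ distribˡ x (- (x ⁻¹)) (x ⁻¹) ⟨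
          x * (- (x ⁻¹) + x ⁻¹)    ≈⟨ *-congˡ (-‿inverseˡ (x ⁻¹)) ⟩
          x * 0#                   ≈⟨ zeroʳ x ⟩
          0#                       ∎)
        (+-monoˡ-≤ 1# (*-nonNeg (proj₁ 0<x) 0≤-x⁻¹))

    ⁻¹-anti : ∀ {x y} → 0# < x → x ≤ y → y ⁻¹ ≤ x ⁻¹
    ⁻¹-anti {x} {y} 0<x x≤y =
      ≤-resp e₁ e₂ (*-monoʳ (*-nonNeg (⁻¹-nonNeg 0<x) (⁻¹-nonNeg 0<y)) x≤y)
      where
      0<y : 0# < y
      0<y = <-≤-trans 0<x x≤y
      e₁ : x * (x ⁻¹ * y ⁻¹) ≈ y ⁻¹
      e₁ = trans (sym (*-assoc x _ _))
                 (trans (*-congʳ (⁻¹-inverseʳ (pos⇒≉0 0<x))) (*-identityˡ _))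
      e₂ : y * (x ⁻¹ * y ⁻¹) ≈ x ⁻¹
      e₂ = trans (*-congˡ (*-comm _ _))
                 (trans (sym (*-assoc y _ _))
                        (trans (*-congʳ (⁻¹-inverseʳ (pos⇒≉0 0<y))) (*-identityˡ _)))

    fromℕ-nonNeg : ∀ n → 0# ≤ fromℕ n
    fromℕ-nonNeg zero    = ≤-refl
    fromℕ-nonNeg (suc n) = ≤-respˡ-≈ (+-identityˡ 0#) (+-mono 0≤1 (fromℕ-nonNeg n))

    fromℕ-pos : ∀ n → 0# < fromℕ (suc n)
    fromℕ-pos n = <-≤-trans (0≤1 , λ e → 1≉0 (sym e))
      (≤-respˡ-≈ (+-identityʳ 1#) (+-mono ≤-refl (fromℕ-nonNeg n)))

    ·-mono : ∀ n {x y} → x ≤ y → n · x ≤ n · y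
    ·-mono zero    p = ≤-refl
    ·-mono (suc n) p = +-mono p (·-mono n p)

    archimedean : ∀ {ε} C → 0# < ε → ¬ (∀ n → n · ε ≤ C)
    archimedean {ε} C 0<ε h
      with complete (λ x → Lift (a ⊔ ℓ₂) (∃[ n ] x ≈ n · ε))
                    (0# , lift (0 , refl))
                    (C , λ { x (lift (n , e)) → ≤-respˡ-≈ (sym e) (h n) })
    ... | s , ub , lub = <⇒≱ 0<ε
      (+-cancel-≤ s (≤-resp (+-comm s ε) (sym (+-identityˡ s))
        (≤-resp refl (cancel′ s ε) (+-monoˡ-≤ ε (lub (s - ε) ub′)))))
      where
      ub′ : ∀ x → Lift (a ⊔ ℓ₂) (∃[ n ] x ≈ n · ε) → x ≤ s - ε
      ub′ x (lift (n , e)) = +-cancel-≤ ε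
        (≤-resp (trans (+-comm ε (n · ε)) (+-congʳ (sym e))) (sym (cancel′ s ε))
          (ub (suc n · ε) (lift (suc n , refl))))

    squeeze : ∀ {h y} n x → 0# < x → 0# ≤ h → x + suc n · h ≈ y →
              Σ[ l ∈ Steps y x ] Σ[ u ∈ Steps y x ]
              Below _⁻¹ l × Above _⁻¹ u × area u + y ⁻¹ * h ≈ area l + x ⁻¹ * h
    squeeze {h} {y} zero x 0<x 0≤h e =
      last x≤y (y ⁻¹) , last x≤y (x ⁻¹) ,
      (λ u i j → ⁻¹-anti (<-≤-trans 0<x i) j) , (λ u i j → ⁻¹-anti 0<x i) ,
      trans (+-cong (*-congˡ w) (*-congˡ (sym w))) (+-comm _ _)
      where
      x+h≈y : x + h ≈ y
      x+h≈y = trans (+-congˡ (sym (+-identityʳ h))) e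
      x≤y : x ≤ y
      x≤y = ≤-resp (+-identityʳ x) x+h≈y (+-mono ≤-refl 0≤h)
      w : y - x ≈ h
      w = trans (+-congʳ (trans (sym x+h≈y) (+-comm x h))) (cancel h x)
    squeeze {h} {y} (suc n) x 0<x 0≤h e
      with squeeze n (x + h) (<-≤-trans 0<x x≤p) 0≤h (trans (+-assoc x h _) e)
      where
      x≤p : x ≤ x + h
      x≤p = ≤-respˡ-≈ (+-identityʳ x) (+-mono ≤-refl 0≤h)
    ... | l , u , hl , hu , eq =
      step p x≤p (p ⁻¹) l , step p x≤p (x ⁻¹) u ,
      ((λ v i j → ⁻¹-anti (<-≤-trans 0<x i) j) , hl) ,
      ((λ v i j → ⁻¹-anti 0<x i) , hu) ,
      (begin
        (x ⁻¹ * (p - x) + area u) + y ⁻¹ * h  ≈⟨ +-assoc _ _ _ ⟩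
        x ⁻¹ * (p - x) + (area u + y ⁻¹ * h)  ≈⟨ +-cong (*-congˡ w) eq ⟩
        x ⁻¹ * h + (area l + p ⁻¹ * h)        ≈⟨ +-comm _ _ ⟩
        (area l + p ⁻¹ * h) + x ⁻¹ * h        ≈⟨ +-congʳ (+-comm _ _) ⟩
        (p ⁻¹ * h + area l) + x ⁻¹ * h        ≈⟨ +-congʳ (+-congʳ (*-congˡ w)) ⟨
        (p ⁻¹ * (p - x) + area l) + x ⁻¹ * h  ∎)
      where
      p = x + h
      x≤p : x ≤ p
      x≤p = ≤-respˡ-≈ (+-identityʳ x) (+-mono ≤-refl 0≤h)
      w : p - x ≈ h
      w = trans (+-congʳ (+-comm x h)) (cancel h x)

  open Lemmas
  open import Algebra.Properties.Semiring.Mult semiring using (×-congʳ; ×-assoc-*)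
  open import Relation.Binary.Reasoning.Setoid setoid

  -- u⁻¹ is integrable on [x , y] for 0 < x ≤ y.

  ∫⁻¹ : ∀ x y → 0# < x → x ≤ y → ∃[ I ] IsIntegral _⁻¹ x y I
  ∫⁻¹ x y 0<x x≤y
    with complete (λ A → Σ[ s ∈ Steps y x ] (Below _⁻¹ s × A ≈ area s))
                  (_ , last x≤y (y ⁻¹) ,
                   (λ u i j → ⁻¹-anti (<-≤-trans 0<x i) j) , refl)
                  (_ , λ { A (s , hs , e) → ≤-respˡ-≈ (sym e)
                         (lower≤upper s (last x≤y (x ⁻¹)) hs (λ u i j → ⁻¹-anti 0<x i)) })
  ... | I , ub , lub = I , record
    { lower    = λ s hs → ub (area s) (s , hs , refl)
    ; least    = λ K h → lub K λ { A (s , hs , e) → ≤-respˡ-≈ (sym e) (h s hs) }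
    ; upper    = λ s′ hs′ → lub (area s′) λ { A (s , hs , e) →
                   ≤-respˡ-≈ (sym e) (lower≤upper s s′ hs hs′) }
    ; greatest = greatest
    }
    where
    greatest : ∀ K → (∀ (s : Steps y x) → Above _⁻¹ s → K ≤ area s) → K ≤ I
    greatest K hK with K ≤? I
    ... | yes K≤I = K≤I
    ... | no  K≰I = ⊥-elim (archimedean (D * (y - x)) 0<ε bound)
      where
      ε = K - I
      D = x ⁻¹ - y ⁻¹
      I<K : I < K
      I<K = ≰⇒> K≰I
      0<ε : 0# < ε
      0<ε = 0≤y-x (proj₁ I<K) ,
            λ e → proj₂ I<K (trans (sym (+-identityˡ I)) (trans (+-congʳ e) (cancel′ K I)))
      0≤D : 0# ≤ D
      0≤D = 0≤y-x (⁻¹-anti 0<x x≤y)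

      bound : ∀ n → n · ε ≤ D * (y - x)
      bound zero    = *-nonNeg 0≤D (0≤y-x x≤y)
      bound (suc n) = ≤-trans (·-mono (suc n) ε≤Dh) (≤-reflexive sum≈)
        where
        N = fromℕ (suc n)
        h = N ⁻¹ * (y - x)
        0≤h : 0# ≤ h
        0≤h = *-nonNeg (⁻¹-nonNeg (fromℕ-pos n)) (0≤y-x x≤y)
        Nh≈ : suc n · h ≈ y - x
        Nh≈ = begin
          suc n · h              ≈⟨ ×-congʳ (suc n) (*-identityˡ h) ⟨
          suc n · (1# * h)       ≈⟨ ×-assoc-* (suc n) 1# h ⟨
          N * (N ⁻¹ * (y - x))   ≈⟨ *-assoc N _ _ ⟨
          N * N ⁻¹ * (y - x)     ≈⟨ *-congʳ (⁻¹-inverseʳ (pos⇒≉0 (fromℕ-pos n))) ⟩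
          1# * (y - x)           ≈⟨ *-identityˡ _ ⟩
          y - x                  ∎
        sum≈ : suc n · (D * h) ≈ D * (y - x)
        sum≈ = begin
          suc n · (D * h)   ≈⟨ ×-congʳ (suc n) (*-comm D h) ⟩
          suc n · (h * D)   ≈⟨ ×-assoc-* (suc n) h D ⟨
          (suc n · h) * D   ≈⟨ *-congʳ Nh≈ ⟩
          (y - x) * D       ≈⟨ *-comm _ _ ⟩
          D * (y - x)       ∎
        ε≤Dh : ε ≤ D * h
        ε≤Dh with squeeze n x 0<x 0≤h
                  (trans (+-congˡ Nh≈) (trans (+-comm x (y - x)) (cancel′ y x)))
        ... | l , u , hl , hu , eq = +-cancel-≤ (y ⁻¹ * h) (+-cancel-≤ I
          (≤-resp lhs rhs
            (≤-trans (+-monoˡ-≤ (y ⁻¹ * h) (hK u hu))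
              (≤-respˡ-≈ (sym eq)
                (+-monoˡ-≤ (x ⁻¹ * h) (ub (area l) (l , hl , refl)))))))
          where
          lhs : K + y ⁻¹ * h ≈ (ε + y ⁻¹ * h) + I
          lhs = begin
            K + y ⁻¹ * h          ≈⟨ +-congʳ (cancel′ K I) ⟨
            (ε + I) + y ⁻¹ * h    ≈⟨ +-assoc _ _ _ ⟩
            ε + (I + y ⁻¹ * h)    ≈⟨ +-congˡ (+-comm _ _) ⟩
            ε + (y ⁻¹ * h + I)    ≈⟨ +-assoc _ _ _ ⟨
            (ε + y ⁻¹ * h) + I    ∎
          rhs : I + x ⁻¹ * h ≈ (D * h + y ⁻¹ * h) + I
          rhs = begin
            I + x ⁻¹ * h              ≈⟨ +-comm _ _ ⟩
            x ⁻¹ * h + I              ≈⟨ +-congʳ (*-congʳ (cancel′ (x ⁻¹) (y ⁻¹))) ⟨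
            (D + y ⁻¹) * h + I        ≈⟨ +-congʳ (distribʳ h D (y ⁻¹)) ⟩
            (D * h + y ⁻¹ * h) + I    ∎

  -- ln x = ∫₁ˣ du/u for 0 < x, with the usual sign convention for x < 1, and
  -- the junk value 0# for x ≤ 0.

  ln : Carrier → Carrier
  ln x with 0# <? x
  ... | no _ = 0#
  ... | yes 0<x with total 1# x
  ...   | inj₁ 1≤x = proj₁ (∫⁻¹ 1# x (0≤1 , λ e → 1≉0 (sym e)) 1≤x)
  ...   | inj₂ x≤1 = - proj₁ (∫⁻¹ x 1# 0<x x≤1)

  minimum : ∀ {n} .{{_ : NonZero n}} → (Fin n → Carrier) → Carrier
  minimum {suc zero}    f = f fzero
  minimum {suc (suc n)} f = f fzero ⊓ minimum (f ∘ fsuc)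

  -- Σ₁ n f is the sum of f 1, …, f n.

  Σ₁ : ℕ → (ℕ → Carrier) → Carrier
  Σ₁ n f = ∑[ i < n ] f (suc (toℕ i))

  -- A sequence (λ₁ , λ₂ , …) of vectors; only the entries λ₁ , … , λ_τ₂ enter
  -- any definition below, the value at 0 and beyond τ₂ being irrelevant.

  Sequence : ℕ → Set a
  Sequence m = ℕ → Fin m → Carrier

  record IsTargetSequence {m} (B : Fin m → Carrier) (τ₂ : ℕ) (Λ : Sequence m)
                          : Set (a ⊔ ℓ₁ ⊔ ℓ₂) where
    field
      nonNeg   : ∀ t → 1 ℕ.≤ t → t ℕ.≤ τ₂ → ∀ j → 0# ≤ Λ t j
      firstPos : ∀ j → 0# < Λ 1 j
      budget   : ∀ j → Σ₁ τ₂ (λ t → Λ t j) ≤ B j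

  ρ : ∀ {m} → (Fin m → Carrier) → ℕ → Fin m → Carrier
  ρ B T j = B j / fromℕ T

  c : ∀ {m} .{{_ : NonZero m}} → (Fin m → Carrier) → Sequence m → ℕ → Carrier
  c B Λ T = (1# / fromℕ T) * Σ₁ T (λ t → minimum (λ j → Λ t j / ρ B T j) ⊓ 1#)

  -- The minimum of c B Λ T over the integers T ∈ [τ₁ , τ₂], for τ₁ ≤ τ₂.

  min-c : ∀ {m} .{{_ : NonZero m}} → (Fin m → Carrier) → (τ₁ τ₂ : ℕ) →
          Sequence m → Carrier
  min-c B τ₁ τ₂ Λ = minimum {suc (τ₂ ∸ τ₁)} (λ k → c B Λ (τ₁ ℕ.+ toℕ k))

  record IsMaximum {b p} {X : Set b} (P : X → Set p) (g : X → Carrier) (M : Carrier)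
                   : Set (b ⊔ p ⊔ ℓ₁ ⊔ ℓ₂) where
    field
      attained   : ∃[ x ] (P x × g x ≈ M)
      upperBound : ∀ x → P x → g x ≤ M

  ratio : (τ₁ τ₂ : ℕ) → Carrier
  ratio τ₁ τ₂ = 1# / (1# + ln (fromℕ τ₂ / fromℕ τ₁))

  logSequence : ∀ {m} → (Fin m → Carrier) → (τ₁ τ₂ : ℕ) → Sequence m
  logSequence B τ₁ τ₂ t j =
    if does (t ℕ.≤? τ₁)
    then ratio τ₁ τ₂ * (B j / fromℕ τ₁)
    else ratio τ₁ τ₂ * (B j / fromℕ t)

{-# OPTIONS --safe #-}

-- For the logarithmic sequence, Σ_{τ₁ < t ≤ τ₂} 1/t is a lower Riemann sum of
-- ∫ du/u over [1 , τ₂/τ₁] with nodes t/τ₁, hence at most ln (τ₂/τ₁); this is the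
-- budget constraint.  Each summand of c is at least the ratio because λ_t ≥ ratio · B/T
-- for t ≤ T and ratio ≤ 1.
--
-- For the maximum, put y_t = min_j λ_{t,j} / B_j, so that c = Σ_{t ≤ T} min (y_t , 1/T).
-- This is concave and piecewise linear, so maximising its minimum over T subject to
-- y ≥ 0 and Σ y ≤ 1 is a linear program, and Fourier–Motzkin elimination produces an
-- optimal y without any appeal to compactness.  The condition λ₁ > 0 is not closed, but
-- dropping leading zeros of an optimal y does not decrease the value.

module Submission where

open import Defs
open import Data.Bool.Base using (true; false; if_then_else_)
open import Data.Fin.Base using (Fin; toℕ) renaming (zero to fzero; suc to fsuc)
open import Data.Fin.Properties using (toℕ<n)
open import Data.List.Base using (List; []; _∷_; _++_; map; filter; cartesianProductWith)
open import Data.List.Membership.Propositional using (_∈_)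
open import Data.List.Membership.Propositional.Properties
import Data.List.Relation.Unary.All as All
open import Data.List.Relation.Unary.Any using (here; there)
import Data.List.Extrema as Extrema
open import Data.Nat.Base as ℕ using (ℕ; zero; suc; pred; _∸_; NonZero; z≤n; s≤s)
import Data.Nat.Properties as ℕ
open import Data.Product.Base using (_×_; _,_; proj₁; proj₂; Σ-syntax; ∃-syntax)
open import Data.Sum.Base using (inj₁; inj₂)
open import Data.Vec.Base as Vec using (Vec; []; _∷_; zipWith)
open import Function.Base using (_∘_)
open import Level using (_⊔_)
open import Relation.Binary.Bundles using (DecTotalOrder)
open import Relation.Binary.PropositionalEquality as ≡ using (_≡_)
open import Relation.Nullary using (yes; no; does; contradiction)
open import Relation.Nullary.Decidable using (dec-true; dec-false)

module _ {a ℓ₁ ℓ₂} (ℝ : CompleteOrderedField a ℓ₁ ℓ₂) where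

  open CompleteOrderedField ℝ hiding (zero)
  open Lemmas ℝ
  open DecTotalOrder decTotalOrder using (poset)
  open Extrema totalOrder using (argmax; argmax-sel; f[⊥]≤f[argmax]; f[xs]≤f[argmax])
  open import Algebra.Construct.NaturalChoice.Min totalOrder
    using (x⊓y≤x; x⊓y≤y; ⊓-glb; ⊓-cong; ⊓-mono-≤; mono-≤-distrib-⊓)
  open import Algebra.Properties.AbelianGroup +-abelianGroup
    using () renaming (⁻¹-involutive to -‿involutive)
  open import Algebra.Properties.Ring ring using (-‿distribˡ-*; -1*x≈-x)
  open import Algebra.Properties.Semiring.Sum semiring
    using (sum-cong-≋; sum-replicate; sum-replicate-zero; *-distribˡ-sum; *-distribʳ-sum)
  open import Algebra.Properties.Semiring.Mult semiring using (×-congʳ; ×-assoc-*)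
  open import Algebra.Solver.Ring.NaturalCoefficients.Default commutativeSemiring
    using (solve; _:=_; _:+_; _:*_)
  open import Relation.Binary.Properties.DecTotalOrder decTotalOrder using (≮⇒≥)
  open import Relation.Binary.Reasoning.PartialOrder poset

  -- Ordered fields

  0<1 : 0# < 1#
  0<1 = 0≤1 , λ e → 1≉0 (sym e)

  0≤y-x⇒x≤y : ∀ {x y} → 0# ≤ y - x → x ≤ y
  0≤y-x⇒x≤y {x} {y} p = ≤-resp (+-identityˡ x) (cancel′ y x) (+-monoˡ-≤ x p)

  x≤y+z⇒x-z≤y : ∀ {x y z} → x ≤ y + z → x - z ≤ y
  x≤y+z⇒x-z≤y {x} {y} {z} p = ≤-respʳ-≈ (cancel y z) (+-monoˡ-≤ (- z) p)

  x-z≤y⇒x≤y+z : ∀ {x y z} → x - z ≤ y → x ≤ y + z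
  x-z≤y⇒x≤y+z {x} {y} {z} p = ≤-respˡ-≈ (cancel′ x z) (+-monoˡ-≤ z p)

  *-monoˡ : ∀ {z v w} → 0# ≤ z → v ≤ w → z * v ≤ z * w
  *-monoˡ 0≤z v≤w = ≤-resp (*-comm _ _) (*-comm _ _) (*-monoʳ 0≤z v≤w)

  -- The two sides differ by `z * (w - v)`, a nonpositive multiple of a nonnegative number.
  *-antiˡ : ∀ {z v w} → z ≤ 0# → v ≤ w → z * w ≤ z * v
  *-antiˡ {z} {v} {w} z≤0 v≤w = begin
    z * w                ≈⟨ *-congˡ (cancel′ w v) ⟨
    z * ((w - v) + v)    ≈⟨ distribˡ z (w - v) v ⟩
    z * (w - v) + z * v  ≤⟨ +-monoˡ-≤ (z * v) (*-monoʳ (0≤y-x v≤w) z≤0) ⟩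
    0# * (w - v) + z * v ≈⟨ +-congʳ (zeroˡ _) ⟩
    0# + z * v           ≈⟨ +-identityˡ _ ⟩
    z * v                ∎

  ⁻¹-inverseˡ : ∀ {x} → 0# < x → x ⁻¹ * x ≈ 1#
  ⁻¹-inverseˡ 0<x = trans (*-comm _ _) (⁻¹-inverseʳ (pos⇒≉0 0<x))

  ⁻¹-cancelˡ : ∀ {x} y → 0# < x → x ⁻¹ * (x * y) ≈ y
  ⁻¹-cancelˡ y 0<x =
    trans (sym (*-assoc _ _ _)) (trans (*-congʳ (⁻¹-inverseˡ 0<x)) (*-identityˡ y))

  *-⁻¹-cancelˡ : ∀ {x} y → 0# < x → x * (x ⁻¹ * y) ≈ y
  *-⁻¹-cancelˡ y 0<x =
    trans (sym (*-assoc _ _ _)) (trans (*-congʳ (⁻¹-inverseʳ (pos⇒≉0 0<x))) (*-identityˡ y))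

  ⁻¹-cancelʳ : ∀ {x} y → 0# < x → y * x * x ⁻¹ ≈ y
  ⁻¹-cancelʳ y 0<x =
    trans (*-assoc _ _ _) (trans (*-congˡ (⁻¹-inverseʳ (pos⇒≉0 0<x))) (*-identityʳ y))

  *-pos : ∀ {x y} → 0# < x → 0# < y → 0# < x * y
  *-pos {x} {y} 0<x 0<y = *-nonNeg (proj₁ 0<x) (proj₁ 0<y) , λ 0≈xy →
    proj₂ 0<y (trans (sym (zeroʳ (x ⁻¹))) (trans (*-congˡ 0≈xy) (⁻¹-cancelˡ y 0<x)))

  ⁻¹-pos : ∀ {x} → 0# < x → 0# < x ⁻¹
  ⁻¹-pos {x} 0<x = ⁻¹-nonNeg 0<x , λ 0≈x⁻¹ →
    1≉0 (trans (sym (⁻¹-inverseʳ (pos⇒≉0 0<x))) (trans (*-congˡ (sym 0≈x⁻¹)) (zeroʳ x)))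

  ⁻¹-unique : ∀ {x y} → 0# < x → x * y ≈ 1# → y ≈ x ⁻¹
  ⁻¹-unique {x} {y} 0<x xy≈1 =
    trans (sym (⁻¹-cancelˡ y 0<x)) (trans (*-congˡ xy≈1) (*-identityʳ _))

  -- Multiplying the left side by `x` gives `1#`, so it is the inverse of `x`. The identity serves
  -- both the areas over the nodes `n / τ` and the division by `ρ`.
  [x/y]⁻¹*y⁻¹≈x⁻¹ : ∀ {x y} → 0# < x → 0# < y → (x / y) ⁻¹ * y ⁻¹ ≈ x ⁻¹
  [x/y]⁻¹*y⁻¹≈x⁻¹ {x} {y} 0<x 0<y = ⁻¹-unique 0<x (begin-equality
    x * ((x / y) ⁻¹ * y ⁻¹)  ≈⟨ solve 3 (λ x y z → x :* (z :* y) := (x :* y) :* z)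
                                  refl x (y ⁻¹) ((x / y) ⁻¹) ⟩
    x / y * (x / y) ⁻¹       ≈⟨ ⁻¹-inverseʳ (pos⇒≉0 (*-pos 0<x (⁻¹-pos 0<y))) ⟩
    1#                       ∎)

  fromℕ-pos′ : ∀ {n} → 1 ℕ.≤ n → 0# < fromℕ n
  fromℕ-pos′ (s≤s {n = n} _) = fromℕ-pos n

  fromℕ-mono : ∀ {m n} → m ℕ.≤ n → fromℕ m ≤ fromℕ n
  fromℕ-mono {n = n} z≤n = fromℕ-nonNeg n
  fromℕ-mono (s≤s p) = +-mono ≤-refl (fromℕ-mono p)

  -- Linear programming by Fourier–Motzkin elimination

  -- Points of every dimension share this type, so eliminating or setting a variable needs no
  -- conversion; by `eval-cong`, a form in n variables reads only the coordinates below n.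
  Point : Set a
  Point = ℕ → Carrier

  -- An affine form a * z (n - 1) + … + b * z 0 + c is stored as a ∷ … ∷ b ∷ c ∷ [].

  Affine : ℕ → Set a
  Affine n = Vec Carrier (suc n)

  eval : ∀ {n} → Affine n → Point → Carrier
  eval {zero}  (c ∷ []) z = c
  eval {suc n} (a ∷ φ)  z = a * z n + eval φ z

  infixl 6 _⊕_
  infixl 7 _⊛_

  _⊕_ : ∀ {n} → Affine n → Affine n → Affine n
  _⊕_ = zipWith _+_

  _⊛_ : ∀ {n} → Carrier → Affine n → Affine n
  k ⊛ φ = Vec.map (k *_) φ

  const : ∀ {n} → Carrier → Affine n
  const {zero}  c = c ∷ []
  const {suc n} c = 0# ∷ const c

  monomial : ∀ {n k} → Carrier → k ℕ.< n → Affine n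
  monomial {suc n} b k<1+n with ℕ.m<1+n⇒m<n∨m≡n k<1+n
  ... | inj₁ k<n = 0# ∷ monomial b k<n
  ... | inj₂ _   = b ∷ const 0#

  eval-⊕ : ∀ {n} (φ ψ : Affine n) z → eval (φ ⊕ ψ) z ≈ eval φ z + eval ψ z
  eval-⊕ {zero}  (c ∷ []) (d ∷ []) z = refl
  eval-⊕ {suc n} (a ∷ φ)  (b ∷ ψ)  z = trans (+-congˡ (eval-⊕ φ ψ z))
    (solve 5 (λ a b x p q → (a :+ b) :* x :+ (p :+ q) := (a :* x :+ p) :+ (b :* x :+ q))
      refl a b (z n) (eval φ z) (eval ψ z))

  eval-⊛ : ∀ {n} k (φ : Affine n) z → eval (k ⊛ φ) z ≈ k * eval φ z
  eval-⊛ {zero}  k (c ∷ []) z = refl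
  eval-⊛ {suc n} k (a ∷ φ)  z = trans (+-congˡ (eval-⊛ k φ z))
    (solve 4 (λ k a x p → k :* a :* x :+ k :* p := k :* (a :* x :+ p))
      refl k a (z n) (eval φ z))

  0*x+y≈y : ∀ x y → 0# * x + y ≈ y
  0*x+y≈y x y = trans (+-congʳ (zeroˡ x)) (+-identityˡ y)

  eval-const : ∀ {n} c z → eval (const {n} c) z ≈ c
  eval-const {zero}  c z = refl
  eval-const {suc n} c z = trans (0*x+y≈y (z n) _) (eval-const {n} c z)

  eval-monomial : ∀ {n k} b (k<n : k ℕ.< n) z → eval (monomial b k<n) z ≈ b * z k
  eval-monomial {suc n} b k<1+n z with ℕ.m<1+n⇒m<n∨m≡n k<1+n
  ... | inj₁ k<n    = trans (0*x+y≈y (z n) _) (eval-monomial b k<n z)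
  ... | inj₂ ≡.refl = trans (+-congˡ (eval-const {n} 0# z)) (+-identityʳ _)

  eval-cong : ∀ {n} (φ : Affine n) {y z} → (∀ k → k ℕ.< n → y k ≡ z k) → eval φ y ≡ eval φ z
  eval-cong {zero}  (c ∷ []) h = ≡.refl
  eval-cong {suc n} (a ∷ φ)  h =
    ≡.cong₂ _+_ (≡.cong (a *_) (h n ℕ.≤-refl)) (eval-cong φ (λ k k<n → h k (ℕ.m<n⇒m<1+n k<n)))

  Satisfies : ∀ {n} → List (Affine n) → Point → Set (a ⊔ ℓ₂)
  Satisfies {n} S z = ∀ {φ} → φ ∈ S → 0# ≤ eval φ z

  NonNegative : ℕ → Point → Set ℓ₂
  NonNegative n z = ∀ k → k ℕ.< n → 0# ≤ z k

  leading : ∀ {n} → Affine (suc n) → Carrier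
  leading (a ∷ _) = a

  -- The value of the top variable at which the form vanishes, for a nonzero leading coefficient.

  root : ∀ {n} → Affine (suc n) → Affine n
  root (a ∷ φ) = - (a ⁻¹) ⊛ φ

  substitute : ∀ {n} → Affine (suc n) → Affine n → Affine n
  substitute (a ∷ φ) ψ = a ⊛ ψ ⊕ φ

  -- With a positive leading coefficient, the form is thus nonnegative exactly when the top variable
  -- is at least the root.
  factor : ∀ {n} (φ : Affine (suc n)) x z → 0# < leading φ →
           leading φ * x + eval (Vec.tail φ) z ≈ leading φ * (x - eval (root φ) z)
  factor (a ∷ φ) x z 0<a = begin-equality
    a * x + r                   ≈⟨ +-congˡ (*-⁻¹-cancelˡ r 0<a) ⟨
    a * x + a * (a ⁻¹ * r)      ≈⟨ distribˡ a x _ ⟨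
    a * (x + a ⁻¹ * r)          ≈⟨ *-congˡ (+-congˡ (-‿involutive _)) ⟨
    a * (x - - (a ⁻¹ * r))      ≈⟨ *-congˡ (+-congˡ (-‿cong (-‿distribˡ-* (a ⁻¹) r))) ⟩
    a * (x - - (a ⁻¹) * r)      ≈⟨ *-congˡ (+-congˡ (-‿cong (eval-⊛ (- (a ⁻¹)) φ z))) ⟨
    a * (x - eval (root (a ∷ φ)) z)  ∎
    where
    r = eval φ z

  eval-substitute : ∀ {n} (φ : Affine (suc n)) (ψ : Affine n) z →
                    eval (substitute φ ψ) z ≈ leading φ * eval ψ z + eval (Vec.tail φ) z
  eval-substitute (a ∷ φ) ψ z = trans (eval-⊕ (a ⊛ ψ) φ z) (+-congʳ (eval-⊛ a ψ z))

  -- Rising forms bound the top variable from below. Forms with leading coefficient zero are grouped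
  -- with the upper bounds: substituting into them leaves their value unchanged, so they survive
  -- elimination.
  rising falling : ∀ {n} → List (Affine (suc n)) → List (Affine (suc n))
  rising  = filter (λ φ → 0# <? leading φ)
  falling = filter (λ φ → leading φ ≤? 0#)

  -- The head `const 0#` is the sign constraint on the top variable. It also keeps the list
  -- nonempty, so that a largest bound exists and no falling form is lost when nothing rises.
  lowerBounds : ∀ {n} → List (Affine (suc n)) → List (Affine n)
  lowerBounds S = const 0# ∷ map root (rising S)

  eliminate : ∀ {n} → List (Affine (suc n)) → List (Affine n)
  eliminate S = cartesianProductWith substitute (falling S) (lowerBounds S)

  module _ {n} (S : List (Affine (suc n))) where

    greatestBound : Point → Affine n
    greatestBound z = argmax (λ ψ → eval ψ z) (const 0#) (map root (rising S))

    greatestBound∈ : ∀ z → greatestBound z ∈ lowerBounds S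
    greatestBound∈ z with argmax-sel (λ ψ → eval ψ z) (const 0#) (map root (rising S))
    ... | inj₁ e = here e
    ... | inj₂ i = there i

    leastValue : Point → Carrier
    leastValue z = eval (greatestBound z) z

    lowerBound≤leastValue : ∀ z {ψ} → ψ ∈ lowerBounds S → eval ψ z ≤ leastValue z
    lowerBound≤leastValue z (here ≡.refl) = f[⊥]≤f[argmax] {f = λ ψ → eval ψ z} (const 0#) (map root (rising S))
    lowerBound≤leastValue z (there i) =
      All.lookup (f[xs]≤f[argmax] {f = λ ψ → eval ψ z} (const 0#) (map root (rising S))) i

    0≤leastValue : ∀ z → 0# ≤ leastValue z
    0≤leastValue z =
      ≤-respˡ-≈ (eval-const {n} 0# z) (lowerBound≤leastValue z (here ≡.refl))

    lowerBound≤ : ∀ z → 0# ≤ z n → Satisfies S z → ∀ {ψ} → ψ ∈ lowerBounds S → eval ψ z ≤ z n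
    lowerBound≤ z 0≤zn sat (here ≡.refl) = ≤-respˡ-≈ (sym (eval-const {n} 0# z)) 0≤zn
    lowerBound≤ z 0≤zn sat (there i) with ∈-map⁻ root i
    ... | φ@(a ∷ _) , φ∈ , ≡.refl with ∈-filter⁻ (λ φ → 0# <? leading φ) {xs = S} φ∈
    ...   | φ∈S , 0<a = 0≤y-x⇒x≤y (≤-respʳ-≈
      (trans (*-congˡ (factor φ (z n) z 0<a)) (⁻¹-cancelˡ _ 0<a))
      (*-nonNeg (⁻¹-nonNeg 0<a) (sat φ∈S)))

    -- Lowering the top variable to one of its lower bounds cannot decrease a form whose leading
    -- coefficient is at most zero.
    eliminate-sound : ∀ z → 0# ≤ z n → Satisfies S z → Satisfies (eliminate S) z
    eliminate-sound z 0≤zn sat φψ∈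
      with ∈-cartesianProductWith⁻ substitute (falling S) (lowerBounds S) φψ∈
    ... | φ@(a ∷ _) , ψ , φ∈ , ψ∈ , ≡.refl with ∈-filter⁻ (λ φ → leading φ ≤? 0#) {xs = S} φ∈
    ...   | φ∈S , a≤0 = ≤-respʳ-≈ (sym (eval-substitute φ ψ z))
      (≤-trans (sat φ∈S) (+-monoˡ-≤ _ (*-antiˡ a≤0 (lowerBound≤ z 0≤zn sat ψ∈))))

    -- Rising forms are nonnegative because `z n` dominates their roots. For the others, `z n`
    -- equals the bound `ψ`, so their value at `z` is that of a form in `eliminate S`.
    eliminate-complete : ∀ z {ψ} → ψ ∈ lowerBounds S → z n ≈ eval ψ z →
                         (∀ {χ} → χ ∈ lowerBounds S → eval χ z ≤ z n) →
                         Satisfies (eliminate S) z → Satisfies S z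
    eliminate-complete z {ψ} ψ∈ e bound sat {φ@(a ∷ _)} φ∈S with 0# <? a
    ... | yes 0<a = ≤-respʳ-≈ (sym (factor φ (z n) z 0<a)) (*-nonNeg (proj₁ 0<a)
      (0≤y-x (bound (there (∈-map⁺ root (∈-filter⁺ (λ φ → 0# <? leading φ) φ∈S 0<a))))))
    ... | no  0≮a = ≤-respʳ-≈ (trans (eval-substitute φ ψ z) (+-congʳ (*-congˡ (sym e))))
      (sat (∈-cartesianProductWith⁺ substitute
        (∈-filter⁺ (λ φ → leading φ ≤? 0#) φ∈S (≮⇒≥ 0≮a)) ψ∈))

  -- Back substitution and minimisation of one coordinate

  infixl 8 _[_↦_]

  _[_↦_] : Point → ℕ → Carrier → Point
  (z [ n ↦ x ]) k with k ℕ.≟ n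
  ... | yes _ = x
  ... | no  _ = z k

  ↦-at : ∀ z n x → (z [ n ↦ x ]) n ≡ x
  ↦-at z n x with n ℕ.≟ n
  ... | yes _ = ≡.refl
  ... | no ¬p = contradiction ≡.refl ¬p

  ↦-below : ∀ z {n} x k → k ℕ.< n → (z [ n ↦ x ]) k ≡ z k
  ↦-below z {n} x k k<n with k ℕ.≟ n
  ... | yes ≡.refl = contradiction k<n (ℕ.<-irrefl ≡.refl)
  ... | no _ = ≡.refl

  satisfies-cong : ∀ {n} (S : List (Affine n)) {y z} → (∀ k → k ℕ.< n → y k ≡ z k) →
                   Satisfies S y → Satisfies S z
  satisfies-cong S h sat φ∈S = ≤-respʳ-≈ (reflexive (eval-cong _ h)) (sat φ∈S)

  module _ {n} (S : List (Affine (suc n))) (z : Point) where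

    extend : Point
    extend = z [ n ↦ leastValue S z ]

    eval-extend : (φ : Affine n) → eval φ extend ≡ eval φ z
    eval-extend φ = eval-cong φ (↦-below z _)

    extend-nonNeg : NonNegative n z → NonNegative (suc n) extend
    extend-nonNeg nonNeg k k<1+n with ℕ.m<1+n⇒m<n∨m≡n k<1+n
    ... | inj₁ k<n    = ≤-respʳ-≈ (reflexive (≡.sym (↦-below z _ k k<n))) (nonNeg k k<n)
    ... | inj₂ ≡.refl = ≤-respʳ-≈ (reflexive (≡.sym (↦-at z n _))) (0≤leastValue S z)

    extend-satisfies : Satisfies (eliminate S) z → Satisfies S extend
    extend-satisfies sat = eliminate-complete S extend (greatestBound∈ S z)
      (reflexive (≡.trans (↦-at z n _) (≡.sym (eval-extend (greatestBound S z)))))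
      (λ {χ} χ∈ → ≤-resp (reflexive (≡.sym (eval-extend χ))) (reflexive (≡.sym (↦-at z n _)))
        (lowerBound≤leastValue S z χ∈))
      (satisfies-cong (eliminate S) (λ k k<n → ≡.sym (↦-below z _ k k<n)) sat)

  Feasible : ∀ {n} → List (Affine n) → Point → Set (a ⊔ ℓ₂)
  Feasible {n} S z = NonNegative n z × Satisfies S z

  eliminate-feasible : ∀ {n} (S : List (Affine (suc n))) {z} → Feasible S z → Feasible (eliminate S) z
  eliminate-feasible {n} S {z} (nn , sat) =
    (λ k k<n → nn k (ℕ.m<n⇒m<1+n k<n)) , eliminate-sound S z (nn n ℕ.≤-refl) sat

  -- The objective is variable 0, which elimination from the top reaches last. When it is the only
  -- variable left, its largest lower bound is attained and is the minimum; extending a point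
  -- upwards leaves coordinate 0 alone.
  minimise : ∀ n (S : List (Affine (suc n))) → ∃[ z ] Feasible S z →
             ∃[ z ] (Feasible S z × ∀ y → Feasible S y → z 0 ≤ y 0)
  minimise zero S (z , feasible) =
    extend S z ,
    (extend-nonNeg S z (proj₁ z-feasible) , extend-satisfies S z (proj₂ z-feasible)) ,
    -- A form in no variables is constant, so the bound selected at `z` takes the same value at `y`.
    λ { y (nn , sat) → ≤-respˡ-≈
      (reflexive (≡.trans (eval-cong (greatestBound S z) (λ _ ())) (≡.sym (↦-at z 0 _))))
      (lowerBound≤ S y (nn 0 ℕ.≤-refl) sat (greatestBound∈ S z)) }
    where
    z-feasible = eliminate-feasible S feasible
  minimise (suc n) S (z , feasible)
    with minimise n (eliminate S) (z , eliminate-feasible S feasible)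
  ... | y , (nn , sat) , least =
    extend S y , (extend-nonNeg S y nn , extend-satisfies S y sat) ,
    λ x x-feasible → ≤-respˡ-≈ (reflexive (≡.sym (↦-below y {suc n} (leastValue S y) 0 (s≤s z≤n))))
      (least x (eliminate-feasible S x-feasible))

  -- Concave piecewise linear functions

  -- `f` is the pointwise minimum of the forms, expressed by its universal property. Hence
  -- `0# ≤ f z` is equivalent to all forms being nonnegative at `z`, a finite linear system.
  record Concave (n : ℕ) (f : Point → Carrier) : Set (a ⊔ ℓ₂) where
    field
      forms    : List (Affine n)
      f≤form   : ∀ z {φ} → φ ∈ forms → f z ≤ eval φ z
      greatest : ∀ z k → (∀ {φ} → φ ∈ forms → k ≤ eval φ z) → k ≤ f z

  open Concave

  affine-concave : ∀ {n f} (φ : Affine n) → (∀ z → eval φ z ≈ f z) → Concave n f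
  affine-concave φ e .forms = φ ∷ []
  affine-concave φ e .f≤form z (here ≡.refl) = ≤-reflexive (sym (e z))
  affine-concave φ e .greatest z k h = ≤-respʳ-≈ (e z) (h (here ≡.refl))

  const-concave : ∀ {n} c → Concave n (λ _ → c)
  const-concave {n} c = affine-concave (const c) (eval-const {n} c)

  monomial-concave : ∀ {n k} b → k ℕ.< n → Concave n (λ z → b * z k)
  monomial-concave b k<n = affine-concave (monomial b k<n) (eval-monomial b k<n)

  coordinate-concave : ∀ {n k} → k ℕ.< n → Concave n (λ z → z k)
  coordinate-concave k<n =
    affine-concave (monomial 1# k<n) (λ z → trans (eval-monomial 1# k<n z) (*-identityˡ _))

  ⊓-concave : ∀ {n f g} → Concave n f → Concave n g → Concave n (λ z → f z ⊓ g z)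
  ⊓-concave F G .forms = forms F ++ forms G
  ⊓-concave F G .f≤form z φ∈ with ∈-++⁻ (forms F) φ∈
  ... | inj₁ φ∈F = ≤-trans (x⊓y≤x _ _) (f≤form F z φ∈F)
  ... | inj₂ φ∈G = ≤-trans (x⊓y≤y _ _) (f≤form G z φ∈G)
  ⊓-concave F G .greatest z k h =
    ⊓-glb (greatest F z k (h ∘ ∈-++⁺ˡ)) (greatest G z k (h ∘ ∈-++⁺ʳ (forms F)))

  +-concave : ∀ {n f g} → Concave n f → Concave n g → Concave n (λ z → f z + g z)
  +-concave F G .forms = cartesianProductWith _⊕_ (forms F) (forms G)
  +-concave F G .f≤form z φψ∈ with ∈-cartesianProductWith⁻ _⊕_ (forms F) (forms G) φψ∈
  ... | φ , ψ , φ∈ , ψ∈ , ≡.refl =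
    ≤-respʳ-≈ (sym (eval-⊕ φ ψ z)) (+-mono (f≤form F z φ∈) (f≤form G z ψ∈))
  -- A lower bound for all sums of pairs is split by taking the infimum over one summand at a time:
  -- first over `φ` with `ψ` fixed, then over `ψ`.
  +-concave {f = f} {g} F G .greatest z k h =
    ≤-respʳ-≈ (+-comm _ _) (x-z≤y⇒x≤y+z (greatest G z (k - f z) λ {ψ} ψ∈ →
      x≤y+z⇒x-z≤y (≤-respʳ-≈ (+-comm _ _) (x-z≤y⇒x≤y+z (greatest F z (k - eval ψ z) λ {φ} φ∈ →
        x≤y+z⇒x-z≤y (≤-respʳ-≈ (eval-⊕ φ ψ z) (h (∈-cartesianProductWith⁺ _⊕_ φ∈ ψ∈))))))))

  sum-concave : ∀ {n m} {f : Fin m → Point → Carrier} → (∀ i → Concave n (f i)) →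
                Concave n (λ z → sum (λ i → f i z))
  sum-concave {m = zero}  F = const-concave 0#
  sum-concave {m = suc m} F = +-concave (F fzero) (sum-concave (F ∘ fsuc))

  minimum-concave : ∀ {n m} .{{_ : NonZero m}} {f : Fin m → Point → Carrier} →
                    (∀ i → Concave n (f i)) → Concave n (λ z → minimum ℝ (λ i → f i z))
  minimum-concave {m = suc zero}    F = F fzero
  minimum-concave {m = suc (suc m)} F = ⊓-concave (F fzero) (minimum-concave (F ∘ fsuc))

  minimise-concave : ∀ {n F} → Concave (suc n) F →
    let Feasible′ = λ z → NonNegative (suc n) z × 0# ≤ F z in
    ∃[ z ] Feasible′ z → ∃[ z ] (Feasible′ z × ∀ y → Feasible′ y → z 0 ≤ y 0)
  minimise-concave {n} C (z , nn , 0≤Fz)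
    with minimise n (forms C) (z , nn , λ φ∈ → ≤-trans 0≤Fz (f≤form C z φ∈))
  ... | x , (x-nn , sat) , least =
    x , (x-nn , greatest C x 0# sat) ,
    λ { y (y-nn , 0≤Fy) → least y (y-nn , λ φ∈ → ≤-trans 0≤Fy (f≤form C y φ∈)) }

  -- Finite sums and minima

  sum-mono : ∀ {n} {f g : Fin n → Carrier} → (∀ i → f i ≤ g i) → sum f ≤ sum g
  sum-mono {zero}  h = ≤-refl
  sum-mono {suc n} h = +-mono (h fzero) (sum-mono (h ∘ fsuc))

  sum-nonNeg : ∀ {n} {f : Fin n → Carrier} → (∀ i → 0# ≤ f i) → 0# ≤ sum f
  sum-nonNeg {zero}  h = ≤-refl
  sum-nonNeg {suc n} h = ≤-respˡ-≈ (+-identityˡ 0#) (+-mono (h fzero) (sum-nonNeg (h ∘ fsuc)))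

  sum-const : ∀ n x → ∑[ i < n ] x ≈ fromℕ n * x
  sum-const n x = trans (sum-replicate n)
    (trans (×-congʳ n (sym (*-identityˡ x))) (sym (×-assoc-* n 1# x)))

  -- If the first term is not positive, discarding it does not lower the sum, and the empty sum is
  -- not positive.
  sum-pos : ∀ {n} (f : Fin n → Carrier) → 0# < sum f → ∃[ i ] 0# < f i
  sum-pos {zero}  f 0<Σ = contradiction refl (proj₂ 0<Σ)
  sum-pos {suc n} f 0<Σ with 0# <? f fzero
  ... | yes 0<f₀ = fzero , 0<f₀
  ... | no  0≮f₀ with sum-pos (f ∘ fsuc)
        (<-≤-trans 0<Σ (≤-respʳ-≈ (+-identityˡ _) (+-monoˡ-≤ _ (≮⇒≥ 0≮f₀))))
  ...   | i , 0<fᵢ = fsuc i , 0<fᵢ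

  sum-snoc : ∀ n (f : ℕ → Carrier) → ∑[ i < suc n ] f (toℕ i) ≈ ∑[ i < n ] f (toℕ i) + f n
  sum-snoc zero    f = +-comm _ _
  sum-snoc (suc n) f = trans (+-congˡ (sum-snoc n (f ∘ suc))) (sym (+-assoc _ _ _))

  sum-extend : ∀ n {f : ℕ → Carrier} → (∀ i → 0# ≤ f i) →
               ∑[ i < n ] f (toℕ i) ≤ ∑[ i < suc n ] f (toℕ i)
  sum-extend n {f} h = ≤-resp (+-identityʳ _) (sym (sum-snoc n f)) (+-mono ≤-refl (h n))

  minimum-≤ : ∀ {n} .{{_ : NonZero n}} (f : Fin n → Carrier) i → minimum ℝ f ≤ f i
  minimum-≤ {suc zero}    f fzero    = ≤-refl
  minimum-≤ {suc (suc n)} f fzero    = x⊓y≤x _ _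
  minimum-≤ {suc (suc n)} f (fsuc i) = ≤-trans (x⊓y≤y _ _) (minimum-≤ (f ∘ fsuc) i)

  minimum-glb : ∀ {n} .{{_ : NonZero n}} (f : Fin n → Carrier) {k} → (∀ i → k ≤ f i) → k ≤ minimum ℝ f
  minimum-glb {suc zero}    f h = h fzero
  minimum-glb {suc (suc n)} f h = ⊓-glb (h fzero) (minimum-glb (f ∘ fsuc) (h ∘ fsuc))

  minimum-mono : ∀ {n} .{{_ : NonZero n}} {f g : Fin n → Carrier} → (∀ i → f i ≤ g i) →
                 minimum ℝ f ≤ minimum ℝ g
  minimum-mono h = minimum-glb _ (λ i → ≤-trans (minimum-≤ _ i) (h i))

  minimum-cong : ∀ {n} .{{_ : NonZero n}} {f g : Fin n → Carrier} → (∀ i → f i ≈ g i) →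
                 minimum ℝ f ≈ minimum ℝ g
  minimum-cong h = antisym (minimum-mono (≤-reflexive ∘ h)) (minimum-mono (≤-reflexive ∘ sym ∘ h))

  minimum-const : ∀ {n} .{{_ : NonZero n}} {f : Fin n → Carrier} {k} → (∀ i → f i ≈ k) →
                  minimum ℝ f ≈ k
  minimum-const {suc n} {f} h = antisym
    (≤-respʳ-≈ (h fzero) (minimum-≤ f fzero)) (minimum-glb f (≤-reflexive ∘ sym ∘ h))

  *-distribˡ-⊓ : ∀ {k} → 0# ≤ k → ∀ x y → k * (x ⊓ y) ≈ (k * x) ⊓ (k * y)
  *-distribˡ-⊓ 0≤k = mono-≤-distrib-⊓ *-congˡ (*-monoˡ 0≤k)

  *-distribˡ-minimum : ∀ {n} .{{_ : NonZero n}} {k} → 0# ≤ k → (f : Fin n → Carrier) →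
                       k * minimum ℝ f ≈ minimum ℝ (λ i → k * f i)
  *-distribˡ-minimum {suc zero}    0≤k f = refl
  *-distribˡ-minimum {suc (suc n)} 0≤k f =
    trans (*-distribˡ-⊓ 0≤k _ _) (⊓-cong refl (*-distribˡ-minimum 0≤k (f ∘ fsuc)))

  -- A target sequence enters c only through the shares y t = min_j λ_{t+1,j} / B_j.

  value : ℕ → (ℕ → Carrier) → Carrier
  value T y = ∑[ i < T ] (y (toℕ i) ⊓ fromℕ T ⁻¹)

  worstValue : ℕ → ℕ → (ℕ → Carrier) → Carrier
  worstValue τ₁ τ₂ y = minimum ℝ {suc (τ₂ ∸ τ₁)} (λ k → value (τ₁ ℕ.+ toℕ k) y)

  Allocation : ℕ → (ℕ → Carrier) → Set ℓ₂
  Allocation n y = NonNegative n y × ∑[ i < n ] y (toℕ i) ≤ 1#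

  -- Each of the T summands is capped at 1/T. The bound keeps the shortfall 1 - w of an allocation
  -- nonnegative, as the linear program demands of every variable.
  value≤1 : ∀ {T} → 1 ℕ.≤ T → ∀ y → value T y ≤ 1#
  value≤1 {T} 1≤T y = begin
    value T y               ≤⟨ sum-mono {T} (λ i → x⊓y≤y (y (toℕ i)) _) ⟩
    ∑[ i < T ] (fromℕ T ⁻¹) ≈⟨ sum-const T _ ⟩
    fromℕ T * fromℕ T ⁻¹    ≈⟨ ⁻¹-inverseʳ (pos⇒≉0 (fromℕ-pos′ 1≤T)) ⟩
    1#                      ∎

  value-mono : ∀ T {y z} → (∀ i → i ℕ.< T → y i ≤ z i) → value T y ≤ value T z
  value-mono T h = sum-mono {T} (λ i → ⊓-mono-≤ (h (toℕ i) (toℕ<n i)) ≤-refl)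

  -- Existence of an optimal allocation

  module _ {τ₁ τ₂} (τ₁≤τ₂ : τ₁ ℕ.≤ τ₂) where

    horizon≤ : ∀ (k : Fin (suc (τ₂ ∸ τ₁))) → τ₁ ℕ.+ toℕ k ℕ.≤ τ₂
    horizon≤ k = ℕ.≤-trans (ℕ.+-monoʳ-≤ τ₁ (ℕ.≤-pred (toℕ<n k))) (ℕ.≤-reflexive (ℕ.m+[n∸m]≡n τ₁≤τ₂))

    worstValue-mono : ∀ {y z} → (∀ i → i ℕ.< τ₂ → y i ≤ z i) →
                      worstValue τ₁ τ₂ y ≤ worstValue τ₁ τ₂ z
    worstValue-mono h = minimum-mono λ k →
      value-mono (τ₁ ℕ.+ toℕ k) (λ i i<T → h i (ℕ.<-≤-trans i<T (horizon≤ k)))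

    -- Minimise the shortfall z 0, where z 1, …, z τ₂ is an allocation of worst value ≥ 1 − z 0.

    slack : Point → Carrier
    slack z = (1# + ∑[ i < τ₂ ] (- 1# * z (suc (toℕ i)))) ⊓ ((z 0 + worstValue τ₁ τ₂ (z ∘ suc)) + - 1#)

    -- The two arguments of the minimum are the budget and the shortfall constraint, so one concave
    -- function carries both. `horizon≤` keeps every index within the τ₂ share variables.
    slack-concave : Concave (suc τ₂) slack
    slack-concave = ⊓-concave
      (+-concave (const-concave 1#) (sum-concave λ i → monomial-concave (- 1#) (s≤s (toℕ<n i))))
      (+-concave
        (+-concave (coordinate-concave (s≤s z≤n))
          (minimum-concave {m = suc (τ₂ ∸ τ₁)} λ k → sum-concave λ i →
            ⊓-concave (coordinate-concave (s≤s (ℕ.<-≤-trans (toℕ<n i) (horizon≤ k))))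
                      (const-concave _)))
        (const-concave (- 1#)))

    remaining : ∀ (z : Point) → 1# + ∑[ i < τ₂ ] (- 1# * z (suc (toℕ i))) ≈ 1# - (∑[ i < τ₂ ] z (suc (toℕ i)))
    remaining z = +-congˡ (trans (sym (*-distribˡ-sum {τ₂} (- 1#) (λ i → z (suc (toℕ i))))) (-1*x≈-x _))

    slack-nonNeg : ∀ (z : Point) → ∑[ i < τ₂ ] z (suc (toℕ i)) ≤ 1# →
                   1# ≤ z 0 + worstValue τ₁ τ₂ (z ∘ suc) → 0# ≤ slack z
    slack-nonNeg z p q = ⊓-glb (≤-respʳ-≈ (sym (remaining z)) (0≤y-x p)) (0≤y-x q)

    private
      Feasible′ : Point → Set ℓ₂
      Feasible′ z = NonNegative (suc τ₂) z × 0# ≤ slack z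

    leastShortfall : 1 ℕ.≤ τ₁ → ∃[ z ] (Feasible′ z × ∀ y → Feasible′ y → z 0 ≤ y 0)
    leastShortfall 1≤τ₁ = minimise-concave slack-concave (unit , unit-nonNeg , 0≤slack-unit)
      where
      -- Nothing is allocated and the shortfall is 1; this is feasible because the worst value of
      -- the zero sequence is at least 0.
      unit : Point
      unit zero    = 1#
      unit (suc _) = 0#
      unit-nonNeg : NonNegative (suc τ₂) unit
      unit-nonNeg zero    _ = 0≤1
      unit-nonNeg (suc _) _ = ≤-refl
      0≤slack-unit : 0# ≤ slack unit
      0≤slack-unit = slack-nonNeg unit
        (≤-respˡ-≈ (sym (sum-replicate-zero τ₂)) 0≤1)
        (≤-respˡ-≈ (+-identityʳ 1#) (+-mono ≤-refl
          (minimum-glb {suc (τ₂ ∸ τ₁)} _ λ k → sum-nonNeg {τ₁ ℕ.+ toℕ k} λ i →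
            ⊓-glb ≤-refl (⁻¹-nonNeg (fromℕ-pos′ (ℕ.m≤n⇒m≤n+o (toℕ k) 1≤τ₁))))))

    -- An allocation of worst value w is feasible with shortfall 1 - w, so `z 0` is at most 1 - w,
    -- while the constraint on `z` bounds 1 by `z 0` plus its own worst value.
    leastShortfall-optimal : 1 ℕ.≤ τ₁ → ∀ z → 0# ≤ slack z → (∀ y → Feasible′ y → z 0 ≤ y 0) →
      ∀ x → Allocation τ₂ x → worstValue τ₁ τ₂ x ≤ worstValue τ₁ τ₂ (z ∘ suc)
    leastShortfall-optimal 1≤τ₁ z 0≤slack least x (x-nonNeg , Σx≤1) = +-cancel-≤ (z 0) (begin
      w + z 0                            ≤⟨ +-mono ≤-refl (least point (point-nonNeg , 0≤slack-point)) ⟩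
      w + (1# - w)                       ≈⟨ +-comm w (1# - w) ⟩
      (1# - w) + w                       ≈⟨ cancel′ 1# w ⟩
      1#                                 ≤⟨ 0≤y-x⇒x≤y (≤-trans 0≤slack (x⊓y≤y _ _)) ⟩
      z 0 + worstValue τ₁ τ₂ (z ∘ suc)   ≈⟨ +-comm (z 0) (worstValue τ₁ τ₂ (z ∘ suc)) ⟩
      worstValue τ₁ τ₂ (z ∘ suc) + z 0   ∎)
      where
      w : Carrier
      w = worstValue τ₁ τ₂ x
      w≤1 : w ≤ 1#
      w≤1 = ≤-trans (minimum-≤ {suc (τ₂ ∸ τ₁)} _ fzero) (value≤1 (ℕ.m≤n⇒m≤n+o 0 1≤τ₁) x)
      point : Point
      point zero    = 1# - w
      point (suc i) = x i
      point-nonNeg : NonNegative (suc τ₂) point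
      point-nonNeg zero    _          = 0≤y-x w≤1
      point-nonNeg (suc i) (s≤s i<τ₂) = x-nonNeg i i<τ₂
      0≤slack-point : 0# ≤ slack point
      0≤slack-point = slack-nonNeg point Σx≤1 (≤-reflexive (sym (cancel′ 1# w)))

    optimalAllocation : 1 ℕ.≤ τ₁ →
      ∃[ y ] (Allocation τ₂ y × ∀ x → Allocation τ₂ x → worstValue τ₁ τ₂ x ≤ worstValue τ₁ τ₂ y)
    optimalAllocation 1≤τ₁ = shortfall⇒allocation (leastShortfall 1≤τ₁)
      where
      shortfall⇒allocation : ∃[ z ] (Feasible′ z × ∀ y → Feasible′ y → z 0 ≤ y 0) →
        ∃[ y ] (Allocation τ₂ y × ∀ x → Allocation τ₂ x → worstValue τ₁ τ₂ x ≤ worstValue τ₁ τ₂ y)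
      shortfall⇒allocation (z , (z-nonNeg , 0≤slack) , least) =
        z ∘ suc ,
        ((λ i i<τ₂ → z-nonNeg (suc i) (s≤s i<τ₂)) ,
         0≤y-x⇒x≤y (≤-respʳ-≈ (remaining z) (≤-trans 0≤slack (x⊓y≤x _ _)))) ,
        leastShortfall-optimal 1≤τ₁ z 0≤slack least

  -- Allocations with a positive first entry

  -- Setting the entries from n on to zero makes nonnegativity and the bound on partial sums hold at
  -- every index, so both survive a shift of the sequence.
  truncate : ℕ → (ℕ → Carrier) → ℕ → Carrier
  truncate zero    y i       = 0#
  truncate (suc n) y zero    = y 0
  truncate (suc n) y (suc i) = truncate n (y ∘ suc) i

  truncate-below : ∀ {n} y i → i ℕ.< n → truncate n y i ≡ y i
  truncate-below {suc n} y zero    _         = ≡.refl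
  truncate-below {suc n} y (suc i) (s≤s i<n) = truncate-below (y ∘ suc) i i<n

  truncate-nonNeg : ∀ {n y} → NonNegative n y → ∀ i → 0# ≤ truncate n y i
  truncate-nonNeg {zero}  h i       = ≤-refl
  truncate-nonNeg {suc n} h zero    = h 0 (s≤s z≤n)
  truncate-nonNeg {suc n} h (suc i) = truncate-nonNeg {n} (λ k k<n → h (suc k) (s≤s k<n)) i

  sum-truncate : ∀ {n y} → NonNegative n y → ∀ k →
                 ∑[ i < k ] truncate n y (toℕ i) ≤ ∑[ i < n ] y (toℕ i)
  sum-truncate {zero}  h k       = ≤-reflexive (sum-replicate-zero k)
  sum-truncate {suc n} h zero    = sum-nonNeg {suc n} (λ i → h (toℕ i) (toℕ<n i))
  sum-truncate {suc n} h (suc k) =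
    +-mono ≤-refl (sum-truncate {n} (λ i i<n → h (suc i) (s≤s i<n)) k)

  -- The shift discards a summand that is at most 0 and brings in a nonnegative one at the end of
  -- the horizon.
  value-tail : ∀ {y} → (∀ i → 0# ≤ y i) → y 0 ≤ 0# → ∀ T → value T y ≤ value T (y ∘ suc)
  value-tail {y} h y₀≤0 zero      = ≤-refl
  value-tail {y} h y₀≤0 T@(suc n) = begin
    (y 0 ⊓ fromℕ T ⁻¹) + ∑[ i < n ] capped (toℕ i)  ≤⟨ +-monoˡ-≤ _ (≤-trans (x⊓y≤x _ _) y₀≤0) ⟩
    0# + ∑[ i < n ] capped (toℕ i)                  ≈⟨ +-identityˡ _ ⟩
    ∑[ i < n ] capped (toℕ i)                       ≤⟨ sum-extend n (λ i → ⊓-glb (h (suc i)) (⁻¹-nonNeg (fromℕ-pos n))) ⟩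
    ∑[ i < T ] capped (toℕ i)                       ∎
    where
    capped : ℕ → Carrier
    capped i = y (suc i) ⊓ fromℕ T ⁻¹

  -- Induction on the position k of a known positive entry: while the first entry is not positive, a
  -- shift moves that entry one place towards the front.
  dropZeros : ∀ k y → (∀ i → 0# ≤ y i) → (∀ n → ∑[ i < n ] y (toℕ i) ≤ 1#) → 0# < y k →
    ∃[ x ] ((∀ i → 0# ≤ x i) × (∀ n → ∑[ i < n ] x (toℕ i) ≤ 1#) × 0# < x 0 ×
            ∀ T → value T y ≤ value T x)
  dropZeros zero    y h Σ≤1 0<yₖ = y , h , Σ≤1 , 0<yₖ , λ _ → ≤-refl
  dropZeros (suc k) y h Σ≤1 0<yₖ with 0# <? y 0
  ... | yes 0<y₀ = y , h , Σ≤1 , 0<y₀ , λ _ → ≤-refl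
  ... | no  0≮y₀ with dropZeros k (y ∘ suc) (h ∘ suc)
        (λ n → ≤-trans (≤-respˡ-≈ (+-identityˡ _) (+-monoˡ-≤ _ (h 0))) (Σ≤1 (suc n))) 0<yₖ
  ...   | x , x-nonNeg , Σx≤1 , 0<x₀ , v≤ =
    x , x-nonNeg , Σx≤1 , 0<x₀ , λ T → ≤-trans (value-tail h (≮⇒≥ 0≮y₀) T) (v≤ T)

  -- The value at horizon τ₁ is a positive sum, so some summand is positive and with it the entry
  -- that it caps; this is the entry from which `dropZeros` starts.
  startPositive : ∀ {τ₁ τ₂ y} → τ₁ ℕ.≤ τ₂ → Allocation τ₂ y → 0# < worstValue τ₁ τ₂ y →
    ∃[ x ] (Allocation τ₂ x × 0# < x 0 × worstValue τ₁ τ₂ y ≤ worstValue τ₁ τ₂ x)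
  startPositive {τ₁} {τ₂} {y} τ₁≤τ₂ (h , Σ≤1) 0<w
    with sum-pos {τ₁ ℕ.+ 0} _ (<-≤-trans 0<w (≤-trans (minimum-≤ {suc (τ₂ ∸ τ₁)} _ fzero)
           (value-mono (τ₁ ℕ.+ 0) λ i i<T → ≤-reflexive (reflexive (≡.sym
             (truncate-below y i (ℕ.<-≤-trans i<T (horizon≤ τ₁≤τ₂ fzero))))))))
  ... | k , 0<yₖ
    with dropZeros (toℕ k) (truncate τ₂ y) (truncate-nonNeg h)
           (λ n → ≤-trans (sum-truncate h n) Σ≤1) (<-≤-trans 0<yₖ (x⊓y≤x _ _))
  ... | x , x-nonNeg , Σx≤1 , 0<x₀ , v≤ =
    x , ((λ i _ → x-nonNeg i) , Σx≤1 τ₂) , 0<x₀ ,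
    ≤-trans (worstValue-mono τ₁≤τ₂ (λ i i<τ₂ → ≤-reflexive (reflexive (≡.sym (truncate-below y i i<τ₂)))))
            (minimum-mono {suc (τ₂ ∸ τ₁)} (λ k → v≤ (τ₁ ℕ.+ toℕ k)))

  -- The logarithm and the harmonic sum

  ln-lower : ∀ {x} → 1# ≤ x → (s : Steps ℝ x 1#) → Below ℝ _⁻¹ s → area ℝ s ≤ ln ℝ x
  ln-lower {x} 1≤x s below with 0# <? x
  ... | no  0≮x = contradiction (<-≤-trans 0<1 1≤x) 0≮x
  ... | yes 0<x with total 1# x
  ...   | inj₁ 1≤x′ = IsIntegral.lower (proj₂ (∫⁻¹ ℝ 1# x 0<1 1≤x′)) s below
  -- Together with `1≤x` this branch of `ln` forces x ≈ 1. The interval has zero width, so the area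
  -- is at most 0, and so is the integral, which enters with a minus sign.
  ...   | inj₂ x≤1  = ≤-trans area≤0 (≤-respʳ-≈ (+-identityˡ _) (0≤y-x I≤0))
    where
    x≈1 : x ≈ 1#
    x≈1 = antisym x≤1 1≤x
    area≤0 : area ℝ s ≤ 0#
    area≤0 = ≤-respʳ-≈ (trans (*-congˡ (trans (+-congʳ x≈1) (-‿inverseʳ 1#))) (zeroʳ _))
      (lower≤upper s (last 1≤x (1# ⁻¹)) below (λ u i _ → ⁻¹-anti 0<1 i))
    I≤0 : proj₁ (∫⁻¹ ℝ x 1# 0<x x≤1) ≤ 0#
    I≤0 = ≤-respʳ-≈ (trans (*-congˡ (trans (+-congʳ (sym x≈1)) (-‿inverseʳ x))) (zeroʳ _))
      (IsIntegral.upper (proj₂ (∫⁻¹ ℝ x 1# 0<x x≤1)) (last x≤1 (x ⁻¹)) (λ u i _ → ⁻¹-anti 0<x i))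

  ln-nonNeg : ∀ {x} → 1# ≤ x → 0# ≤ ln ℝ x
  ln-nonNeg 1≤x = ≤-respˡ-≈ (zeroˡ _)
    (ln-lower 1≤x (last 1≤x 0#) (λ u 1≤u _ → ⁻¹-nonNeg (<-≤-trans 0<1 1≤u)))

  -- Since `_⁻¹` is decreasing, its value at the right end of a piece is a lower bound there. End
  -- points are matched up to `_≈_` because `Steps` is indexed by terms, and the first node τ/τ is
  -- only equivalent to `1#`.
  lowerSteps : ∀ k (p : ℕ → Carrier) → (∀ i → p i ≤ p (suc i)) →
               ∀ {x y} → 0# < x → x ≈ p 0 → p k ≈ y →
               Σ[ s ∈ Steps ℝ y x ] (Below ℝ _⁻¹ s ×
                 area ℝ s ≈ ∑[ i < k ] (p (suc (toℕ i)) ⁻¹ * (p (suc (toℕ i)) - p (toℕ i))))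
  lowerSteps zero p mono {x} {y} 0<x x≈p₀ p₀≈y =
    -- `Steps` has no empty case, so the partition closes with a piece of zero width and zero area.
    last (≤-reflexive x≈y) (y ⁻¹) , (λ u x≤u u≤y → ⁻¹-anti (<-≤-trans 0<x x≤u) u≤y) ,
    trans (*-congˡ (trans (+-congʳ (sym x≈y)) (-‿inverseʳ x))) (zeroʳ _)
    where
    x≈y : x ≈ y
    x≈y = trans x≈p₀ p₀≈y
  lowerSteps (suc k) p mono {x} 0<x x≈p₀ pₖ≈y
    with lowerSteps k (p ∘ suc) (mono ∘ suc) (<-≤-trans 0<x (≤-respˡ-≈ (sym x≈p₀) (mono 0))) refl pₖ≈y
  ... | s , below , e =
    step (p 1) (≤-respˡ-≈ (sym x≈p₀) (mono 0)) (p 1 ⁻¹) s ,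
    ((λ u x≤u u≤p₁ → ⁻¹-anti (<-≤-trans 0<x x≤u) u≤p₁) , below) ,
    +-cong (*-congˡ (+-congˡ (-‿cong x≈p₀))) e

  module _ {τ} (1≤τ : 1 ℕ.≤ τ) where

    private
      0<τ : 0# < fromℕ τ
      0<τ = fromℕ-pos′ 1≤τ

    /-mono : ∀ {m n} → m ℕ.≤ n → fromℕ m / fromℕ τ ≤ fromℕ n / fromℕ τ
    /-mono m≤n = *-monoʳ (⁻¹-nonNeg 0<τ) (fromℕ-mono m≤n)

    1≤n/τ : ∀ {n} → τ ℕ.≤ n → 1# ≤ fromℕ n / fromℕ τ
    1≤n/τ τ≤n = ≤-respˡ-≈ (⁻¹-inverseʳ (pos⇒≉0 0<τ)) (/-mono τ≤n)

    harmonic≤ln : ∀ k → ∑[ i < k ] (fromℕ (suc (toℕ i ℕ.+ τ)) ⁻¹) ≤ ln ℝ (fromℕ (k ℕ.+ τ) / fromℕ τ)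
    harmonic≤ln k
      with lowerSteps k (λ i → fromℕ (i ℕ.+ τ) / fromℕ τ) (λ i → /-mono (ℕ.n≤1+n (i ℕ.+ τ)))
             0<1 (sym (⁻¹-inverseʳ (pos⇒≉0 0<τ))) refl
    ... | s , below , e = ≤-respˡ-≈ (trans e (sum-cong-≋ {k} (λ i → piece (toℕ i ℕ.+ τ))))
      (ln-lower (1≤n/τ (ℕ.m≤n+m τ k)) s below)
      where
      -- The piece from n/τ to (n+1)/τ has width 1/τ and height τ/(n+1).
      piece : ∀ n → (fromℕ (suc n) / fromℕ τ) ⁻¹ * (fromℕ (suc n) / fromℕ τ - fromℕ n / fromℕ τ)
                    ≈ fromℕ (suc n) ⁻¹
      piece n = trans
        (*-congˡ (trans (+-congʳ (trans (distribʳ _ 1# (fromℕ n)) (+-congʳ (*-identityˡ _)))) (cancel _ _)))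
        ([x/y]⁻¹*y⁻¹≈x⁻¹ (fromℕ-pos n) 0<τ)

  -- weight τ t = 1 / max τ t, the entry of logSequence at t up to the factor ratio * B.

  weight : ℕ → ℕ → Carrier
  weight τ t = if does (t ℕ.≤? τ) then fromℕ τ ⁻¹ else fromℕ t ⁻¹

  weight-≤ : ∀ {τ t} → t ℕ.≤ τ → weight τ t ≡ fromℕ τ ⁻¹
  weight-≤ {τ} {t} t≤τ rewrite dec-true (t ℕ.≤? τ) t≤τ = ≡.refl

  weight-> : ∀ {τ t} → τ ℕ.< t → weight τ t ≡ fromℕ t ⁻¹
  weight-> {τ} {t} τ<t rewrite dec-false (t ℕ.≤? τ) (ℕ.<⇒≱ τ<t) = ≡.refl

  -- The weight is the inverse of either τ or t, and both are at most T.
  ⁻¹≤weight : ∀ {τ t T} → 1 ℕ.≤ τ → 1 ℕ.≤ t → τ ℕ.≤ T → t ℕ.≤ T → fromℕ T ⁻¹ ≤ weight τ t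
  ⁻¹≤weight {τ} {t} 1≤τ 1≤t τ≤T t≤T with does (t ℕ.≤? τ)
  ... | true  = ⁻¹-anti (fromℕ-pos′ 1≤τ) (fromℕ-mono τ≤T)
  ... | false = ⁻¹-anti (fromℕ-pos′ 1≤t) (fromℕ-mono t≤T)

  weight-pos : ∀ {τ t} → 1 ℕ.≤ τ → 1 ℕ.≤ t → 0# < weight τ t
  weight-pos {τ} {t} 1≤τ 1≤t with does (t ℕ.≤? τ)
  ... | true  = ⁻¹-pos (fromℕ-pos′ 1≤τ)
  ... | false = ⁻¹-pos (fromℕ-pos′ 1≤t)

  -- The first τ entries are 1/τ each and sum to 1. Writing the length as k + τ lets the induction
  -- peel off the last entry, which lies past τ.
  sum-weight : ∀ {τ} → 1 ℕ.≤ τ → ∀ k →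
    Σ₁ ℝ (k ℕ.+ τ) (weight τ) ≈ 1# + ∑[ i < k ] (fromℕ (suc (toℕ i ℕ.+ τ)) ⁻¹)
  sum-weight {τ} 1≤τ zero = begin-equality
    Σ₁ ℝ τ (weight τ)          ≈⟨ sum-cong-≋ {τ} (λ i → reflexive (weight-≤ (toℕ<n i))) ⟩
    ∑[ i < τ ] (fromℕ τ ⁻¹)    ≈⟨ sum-const τ _ ⟩
    fromℕ τ * fromℕ τ ⁻¹       ≈⟨ ⁻¹-inverseʳ (pos⇒≉0 (fromℕ-pos′ 1≤τ)) ⟩
    1#                         ≈⟨ +-identityʳ 1# ⟨
    1# + 0#                    ∎
  sum-weight {τ} 1≤τ (suc k) = begin-equality
    Σ₁ ℝ (suc k ℕ.+ τ) (weight τ)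
      ≈⟨ sum-snoc (k ℕ.+ τ) (weight τ ∘ suc) ⟩
    Σ₁ ℝ (k ℕ.+ τ) (weight τ) + weight τ (suc (k ℕ.+ τ))
      ≈⟨ +-cong (sum-weight 1≤τ k) (reflexive (weight-> (s≤s (ℕ.m≤n+m τ k)))) ⟩
    (1# + ∑[ i < k ] h (toℕ i)) + h k
      ≈⟨ +-assoc _ _ _ ⟩
    1# + (∑[ i < k ] h (toℕ i) + h k)
      ≈⟨ +-congˡ (sum-snoc k h) ⟨
    1# + ∑[ i < suc k ] h (toℕ i)
      ∎
    where
    h : ℕ → Carrier
    h i = fromℕ (suc (i ℕ.+ τ)) ⁻¹

  sum-weight≤ : ∀ {τ₁ τ₂} → 1 ℕ.≤ τ₁ → τ₁ ℕ.≤ τ₂ →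
                Σ₁ ℝ τ₂ (weight τ₁) ≤ 1# + ln ℝ (fromℕ τ₂ / fromℕ τ₁)
  sum-weight≤ {τ₁} {τ₂} 1≤τ₁ τ₁≤τ₂ =
    ≡.subst (λ n → Σ₁ ℝ n (weight τ₁) ≤ 1# + ln ℝ (fromℕ n / fromℕ τ₁)) (ℕ.m∸n+n≡m τ₁≤τ₂)
      (≤-respˡ-≈ (sym (sum-weight 1≤τ₁ (τ₂ ∸ τ₁))) (+-mono ≤-refl (harmonic≤ln 1≤τ₁ (τ₂ ∸ τ₁))))

  -- Passage between target sequences and allocations

  module _ {m} .{{_ : NonZero m}} {B : Fin m → Carrier} (0<B : ∀ j → 0# < B j) where

    share : Sequence ℝ m → ℕ → Carrier
    share Λ i = minimum ℝ (λ j → Λ (suc i) j / B j)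

    -- The factor 1/T is nonnegative, so it moves through the sum and both minima; there it turns
    -- λ/(B/T) into λ/B and the cap 1 into 1/T.
    c≈value : ∀ Λ {T} → 1 ℕ.≤ T → c ℝ B Λ T ≈ value T (share Λ)
    c≈value Λ {T} 1≤T =
      trans (*-distribˡ-sum {T} k _) (sum-cong-≋ {T} (λ i → begin-equality
        k * (minimum ℝ (λ j → Λ (suc (toℕ i)) j / ρ ℝ B T j) ⊓ 1#)
          ≈⟨ *-distribˡ-⊓ 0≤k _ _ ⟩
        (k * minimum ℝ (λ j → Λ (suc (toℕ i)) j / ρ ℝ B T j)) ⊓ (k * 1#)
          ≈⟨ ⊓-cong (*-distribˡ-minimum 0≤k _) (trans (*-identityʳ k) k≈T⁻¹) ⟩
        minimum ℝ (λ j → k * (Λ (suc (toℕ i)) j / ρ ℝ B T j)) ⊓ fromℕ T ⁻¹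
          ≈⟨ ⊓-cong (minimum-cong (λ j → rescale (Λ (suc (toℕ i)) j) j)) refl ⟩
        share Λ (toℕ i) ⊓ fromℕ T ⁻¹
          ∎))
      where
      0<T : 0# < fromℕ T
      0<T = fromℕ-pos′ 1≤T
      k = 1# / fromℕ T
      k≈T⁻¹ : k ≈ fromℕ T ⁻¹
      k≈T⁻¹ = *-identityˡ _
      0≤k : 0# ≤ k
      0≤k = ≤-respʳ-≈ (sym k≈T⁻¹) (⁻¹-nonNeg 0<T)
      rescale : ∀ l j → k * (l / ρ ℝ B T j) ≈ l / B j
      rescale l j = begin-equality
        k * (l * ρ ℝ B T j ⁻¹)           ≈⟨ *-congʳ k≈T⁻¹ ⟩
        fromℕ T ⁻¹ * (l * ρ ℝ B T j ⁻¹)  ≈⟨ solve 3 (λ t l r → t :* (l :* r) := l :* (r :* t))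
                                              refl (fromℕ T ⁻¹) l (ρ ℝ B T j ⁻¹) ⟩
        l * (ρ ℝ B T j ⁻¹ * fromℕ T ⁻¹)  ≈⟨ *-congˡ ([x/y]⁻¹*y⁻¹≈x⁻¹ (0<B j) 0<T) ⟩
        l / B j                          ∎

    min-c≈worstValue : ∀ {τ₁ τ₂} Λ → 1 ℕ.≤ τ₁ → min-c ℝ B τ₁ τ₂ Λ ≈ worstValue τ₁ τ₂ (share Λ)
    min-c≈worstValue {τ₁} {τ₂} Λ 1≤τ₁ =
      minimum-cong {suc (τ₂ ∸ τ₁)} (λ k → c≈value Λ (ℕ.m≤n⇒m≤n+o (toℕ k) 1≤τ₁))

    share-allocation : ∀ {n Λ} → IsTargetSequence ℝ B n Λ → Allocation n (share Λ)
    share-allocation {n} {Λ} target =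
      (λ i i<n → minimum-glb _ (λ j →
        *-nonNeg (nonNeg (suc i) (s≤s z≤n) i<n j) (⁻¹-nonNeg (0<B j)))) ,
      sum≤1 (firstIndex m)
      where
      open IsTargetSequence target
      -- The budget of a single resource bounds the sum, as the share is at most each quotient; m ≥
      -- 1 provides one.
      firstIndex : ∀ m .{{_ : NonZero m}} → Fin m
      firstIndex (suc _) = fzero
      sum≤1 : Fin m → ∑[ i < n ] share Λ (toℕ i) ≤ 1#
      sum≤1 j = begin
        ∑[ i < n ] share Λ (toℕ i)              ≤⟨ sum-mono {n} (λ i → minimum-≤ _ j) ⟩
        ∑[ i < n ] (Λ (suc (toℕ i)) j / B j)    ≈⟨ *-distribʳ-sum {n} (B j ⁻¹) _ ⟨
        Σ₁ ℝ n (λ t → Λ t j) / B j              ≤⟨ *-monoʳ (⁻¹-nonNeg (0<B j)) (budget j) ⟩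
        B j / B j                               ≈⟨ ⁻¹-inverseʳ (pos⇒≉0 (0<B j)) ⟩
        1#                                      ∎

    -- All resources are consumed in proportion to `B`. Shares are numbered from 0 and sequences
    -- from 1, hence `pred`.
    allocate : (ℕ → Carrier) → Sequence ℝ m
    allocate y t j = y (pred t) * B j

    share-allocate : ∀ y i → share (allocate y) i ≈ y i
    share-allocate y i = minimum-const (λ j → ⁻¹-cancelʳ (y i) (0<B j))

    allocate-target : ∀ {n y} → Allocation n y → 0# < y 0 → IsTargetSequence ℝ B n (allocate y)
    allocate-target (nn , Σ≤1) 0<y₀ .IsTargetSequence.nonNeg (suc i) _ i<n j =
      *-nonNeg (nn i i<n) (proj₁ (0<B j))
    allocate-target (nn , Σ≤1) 0<y₀ .IsTargetSequence.firstPos j = *-pos 0<y₀ (0<B j)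
    allocate-target {n} {y} (nn , Σ≤1) 0<y₀ .IsTargetSequence.budget j = begin
      ∑[ i < n ] (y (toℕ i) * B j)    ≈⟨ *-distribʳ-sum {n} (B j) (λ i → y (toℕ i)) ⟨
      (∑[ i < n ] y (toℕ i)) * B j    ≤⟨ *-monoʳ (proj₁ (0<B j)) Σ≤1 ⟩
      1# * B j                        ≈⟨ *-identityˡ _ ⟩
      B j                             ∎

    -- The sequence `Λ₀` makes the optimal worst value positive, so `startPositive` can arrange the
    -- strict condition on the first vector. `share` carries every target sequence to an allocation
    -- of the same worst value, and `allocate` brings the adjusted optimum back.
    maximum-exists : ∀ {τ₁ τ₂ Λ₀} → 1 ℕ.≤ τ₁ → τ₁ ℕ.≤ τ₂ →
      IsTargetSequence ℝ B τ₂ Λ₀ → 0# < min-c ℝ B τ₁ τ₂ Λ₀ →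
      ∃[ M ] IsMaximum ℝ (IsTargetSequence ℝ B τ₂) (min-c ℝ B τ₁ τ₂) M
    maximum-exists {τ₁} {τ₂} {Λ₀} 1≤τ₁ τ₁≤τ₂ target₀ 0<min₀ =
      fromOptimal (optimalAllocation τ₁≤τ₂ 1≤τ₁)
      where
      Maximum = ∃[ M ] IsMaximum ℝ (IsTargetSequence ℝ B τ₂) (min-c ℝ B τ₁ τ₂) M
      Optimal : (ℕ → Carrier) → Set (a ⊔ ℓ₂)
      Optimal y = ∀ x → Allocation τ₂ x → worstValue τ₁ τ₂ x ≤ worstValue τ₁ τ₂ y

      fromPositive : ∀ {y} → Optimal y →
        ∃[ x ] (Allocation τ₂ x × 0# < x 0 × worstValue τ₁ τ₂ y ≤ worstValue τ₁ τ₂ x) → Maximum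
      fromPositive {y} optimal (x , x-allocation , 0<x₀ , y≤x) = min-c ℝ B τ₁ τ₂ (allocate x) , record
        { attained   = allocate x , allocate-target x-allocation 0<x₀ , refl
        ; upperBound = λ Λ target → begin
            min-c ℝ B τ₁ τ₂ Λ                     ≈⟨ min-c≈worstValue {τ₂ = τ₂} Λ 1≤τ₁ ⟩
            worstValue τ₁ τ₂ (share Λ)            ≤⟨ optimal (share Λ) (share-allocation target) ⟩
            worstValue τ₁ τ₂ y                    ≤⟨ y≤x ⟩
            worstValue τ₁ τ₂ x                    ≤⟨ worstValue-mono τ₁≤τ₂ (λ i _ →
                                                       ≤-reflexive (sym (share-allocate x i))) ⟩
            worstValue τ₁ τ₂ (share (allocate x)) ≈⟨ min-c≈worstValue {τ₂ = τ₂} (allocate x) 1≤τ₁ ⟨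
            min-c ℝ B τ₁ τ₂ (allocate x)          ∎
        }

      fromOptimal : ∃[ y ] (Allocation τ₂ y × Optimal y) → Maximum
      fromOptimal (y , y-allocation , optimal) =
        fromPositive {y} optimal (startPositive {y = y} τ₁≤τ₂ y-allocation
          (<-≤-trans 0<min₀ (≤-respˡ-≈ (sym (min-c≈worstValue {τ₂ = τ₂} Λ₀ 1≤τ₁))
            (optimal (share Λ₀) (share-allocation target₀)))))

    -- The logarithmic sequence

    module _ {τ₁ τ₂} (1≤τ₁ : 1 ℕ.≤ τ₁) (τ₁≤τ₂ : τ₁ ℕ.≤ τ₂) where

      private
        r L : Carrier
        r = ratio ℝ τ₁ τ₂
        L = ln ℝ (fromℕ τ₂ / fromℕ τ₁)
        Λ : Sequence ℝ m
        Λ = logSequence ℝ B τ₁ τ₂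

        1≤1+L : 1# ≤ 1# + L
        1≤1+L = ≤-respˡ-≈ (+-identityʳ 1#) (+-mono ≤-refl (ln-nonNeg (1≤n/τ 1≤τ₁ τ₁≤τ₂)))

        0<1+L : 0# < 1# + L
        0<1+L = <-≤-trans 0<1 1≤1+L

        r≈ : r ≈ (1# + L) ⁻¹
        r≈ = *-identityˡ _

      ratio-pos : 0# < r
      ratio-pos = <-≤-trans (⁻¹-pos 0<1+L) (≤-reflexive (sym r≈))

      ratio≤1 : r ≤ 1#
      ratio≤1 = ≤-resp (sym r≈) (sym (⁻¹-unique 0<1 (*-identityˡ 1#)))
        (⁻¹-anti 0<1 1≤1+L)

      logSequence≈ : ∀ t j → Λ t j ≈ r * B j * weight τ₁ t
      logSequence≈ t j with does (t ℕ.≤? τ₁)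
      ... | true  = sym (*-assoc _ _ _)
      ... | false = sym (*-assoc _ _ _)

      logSequence-pos : ∀ t → 1 ℕ.≤ t → ∀ j → 0# < Λ t j
      logSequence-pos t 1≤t j = <-≤-trans
        (*-pos (*-pos ratio-pos (0<B j)) (weight-pos 1≤τ₁ 1≤t)) (≤-reflexive (sym (logSequence≈ t j)))

      logSequence-budget : ∀ j → Σ₁ ℝ τ₂ (λ t → Λ t j) ≤ B j
      logSequence-budget j = begin
        Σ₁ ℝ τ₂ (λ t → Λ t j)                       ≈⟨ sum-cong-≋ {τ₂} (λ i → logSequence≈ (suc (toℕ i)) j) ⟩
        Σ₁ ℝ τ₂ (λ t → r * B j * weight τ₁ t)       ≈⟨ *-distribˡ-sum {τ₂} (r * B j) _ ⟨
        r * B j * Σ₁ ℝ τ₂ (weight τ₁)               ≤⟨ *-monoˡ (proj₁ (*-pos ratio-pos (0<B j))) (sum-weight≤ 1≤τ₁ τ₁≤τ₂) ⟩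
        r * B j * (1# + L)                          ≈⟨ *-congʳ (*-congʳ r≈) ⟩
        (1# + L) ⁻¹ * B j * (1# + L)                ≈⟨ solve 3 (λ x b y → x :* b :* y := x :* (y :* b))
                                                         refl ((1# + L) ⁻¹) (B j) (1# + L) ⟩
        (1# + L) ⁻¹ * ((1# + L) * B j)              ≈⟨ ⁻¹-cancelˡ (B j) 0<1+L ⟩
        B j                                         ∎

      logSequence-share : ∀ i → share Λ i ≈ r * weight τ₁ (suc i)
      logSequence-share i = minimum-const λ j → begin-equality
        Λ (suc i) j / B j                        ≈⟨ *-congʳ (logSequence≈ (suc i) j) ⟩
        r * B j * weight τ₁ (suc i) / B j        ≈⟨ *-congʳ (solve 3 (λ r b w → r :* b :* w := r :* w :* b)
                                                      refl r (B j) (weight τ₁ (suc i))) ⟩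
        r * weight τ₁ (suc i) * B j / B j        ≈⟨ ⁻¹-cancelʳ _ (0<B j) ⟩
        r * weight τ₁ (suc i)                    ∎

      ratio≤c : ∀ T → τ₁ ℕ.≤ T → r ≤ c ℝ B Λ T
      ratio≤c T τ₁≤T = begin
        r                                  ≈⟨ ⁻¹-cancelʳ r 0<T ⟨
        r * fromℕ T * fromℕ T ⁻¹           ≈⟨ solve 3 (λ r t u → r :* t :* u := t :* (r :* u))
                                                refl r (fromℕ T) (fromℕ T ⁻¹) ⟩
        fromℕ T * (r * fromℕ T ⁻¹)         ≈⟨ sum-const T _ ⟨
        ∑[ i < T ] (r * fromℕ T ⁻¹)        ≤⟨ sum-mono {T} (λ i → ⊓-glb (≤share (toℕ i) (toℕ<n i)) ≤T⁻¹) ⟩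
        value T (share Λ)                  ≈⟨ c≈value Λ 1≤T ⟨
        c ℝ B Λ T                          ∎
        where
        1≤T : 1 ℕ.≤ T
        1≤T = ℕ.≤-trans 1≤τ₁ τ₁≤T
        0<T : 0# < fromℕ T
        0<T = fromℕ-pos′ 1≤T
        ≤T⁻¹ : r * fromℕ T ⁻¹ ≤ fromℕ T ⁻¹
        ≤T⁻¹ = ≤-respʳ-≈ (*-identityˡ _) (*-monoʳ (⁻¹-nonNeg 0<T) ratio≤1)
        ≤share : ∀ i → i ℕ.< T → r * fromℕ T ⁻¹ ≤ share Λ i
        ≤share i i<T = ≤-respʳ-≈ (sym (logSequence-share i))
          (*-monoˡ (proj₁ ratio-pos) (⁻¹≤weight 1≤τ₁ (s≤s z≤n) τ₁≤T i<T))

      logSequence-target : IsTargetSequence ℝ B τ₂ Λ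
      logSequence-target = record
        { nonNeg   = λ t 1≤t _ j → proj₁ (logSequence-pos t 1≤t j)
        ; firstPos = logSequence-pos 1 ℕ.≤-refl
        ; budget   = logSequence-budget
        }

      ratio≤min-c : r ≤ min-c ℝ B τ₁ τ₂ Λ
      ratio≤min-c = minimum-glb {suc (τ₂ ∸ τ₁)} _ (λ k → ratio≤c (τ₁ ℕ.+ toℕ k) (ℕ.m≤m+n τ₁ (toℕ k)))

mainTheorem5 : ∀ {a ℓ₁ ℓ₂} (ℝ : CompleteOrderedField a ℓ₁ ℓ₂) →
    let open CompleteOrderedField ℝ in
    (m : ℕ) .{{_ : NonZero m}} (B : Fin m → Carrier) → (∀ j → 0# < B j) →
    (τ₁ τ₂ : ℕ) → 1 ℕ.≤ τ₁ → τ₁ ℕ.≤ τ₂ →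
    (∀ t → 1 ℕ.≤ t → t ℕ.≤ τ₂ → ∀ j → 0# ≤ logSequence ℝ B τ₁ τ₂ t j) ×
    (∀ j → Σ₁ ℝ τ₂ (λ t → logSequence ℝ B τ₁ τ₂ t j) ≤ B j) ×
    (∀ T → τ₁ ℕ.≤ T → T ℕ.≤ τ₂ →
    ratio ℝ τ₁ τ₂ ≤ c ℝ B (logSequence ℝ B τ₁ τ₂) T) ×
    (∃[ M ] (IsMaximum ℝ (IsTargetSequence ℝ B τ₂) (min-c ℝ B τ₁ τ₂) M ×
    ratio ℝ τ₁ τ₂ ≤ M))
mainTheorem5 ℝ m B 0<B τ₁ τ₂ 1≤τ₁ τ₁≤τ₂ =
  nonNeg , budget , (λ T τ₁≤T _ → ratio≤c ℝ 0<B 1≤τ₁ τ₁≤τ₂ T τ₁≤T) , M , isMaximum ,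
  ≤-trans (ratio≤min-c ℝ 0<B 1≤τ₁ τ₁≤τ₂) (IsMaximum.upperBound isMaximum _ target)
  where
  open CompleteOrderedField ℝ using (≤-trans)
  open Lemmas ℝ using (<-≤-trans)
  target = logSequence-target ℝ 0<B 1≤τ₁ τ₁≤τ₂
  open IsTargetSequence target using (nonNeg; budget)
  -- The logarithmic sequence itself witnesses that a positive worst case is possible.
  maximum = maximum-exists ℝ 0<B 1≤τ₁ τ₁≤τ₂ target
    (<-≤-trans (ratio-pos ℝ 0<B 1≤τ₁ τ₁≤τ₂) (ratio≤min-c ℝ 0<B 1≤τ₁ τ₁≤τ₂))
  M = proj₁ maximum
  isMaximum = proj₂ maximum
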